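{- Let $k\ge 1$ and let $\lambda$ be a strict partition. Then $$RQ^{(k)}_\lambda(X)=\sum_{T'}F_{\mathrm{Des}(T')}(X)=\sum_{T}2^{|\mathrm{Peak}(\mathrm{Des}(T))|+1}\,G_{\mathrm{Peak}(\mathrm{Des}(T))}(X).$$ The first sum runs over all marked standard shifted $k$-ribbon tableaux $T'$ of shape $\lambda$. The second sum runs over all standard shifted $k$-ribbon tableaux $T$ of shape $\lambda$.
   Context: Conventions. Diagrams are drawn in French convention, with rows numbered from the bottom. A strict partition $\lambda=(\lambda_1>\cdots>\lambda_\ell>0)$ is identified with its shifted diagram $\{(c,r):1\le r\le\ell,\ r\le c\le r+\lambda_r-1\}$. The diagonal value of a cell is $c-r+1$, and the main diagonal consists of the cells of value $1$. A subset $R\subseteq\lambda$ is removable if $\lambda\setminus R$ is a shifted diagram. Ribbons. A single ribbon is a nonempty edge-connected skew-shifted diagram with cells on distinct diagonals. Its head $H(R)$ and tail $T(R)$ are its cells of largest and smallest diagonal value. A double ribbon in $\lambda$ is a union $R\cup S$ of disjoint single ribbons with $|R|\ge|S|$ such that $T(R)$ is on the main diagonal of $\lambda$, $T(S)$ is on the main diagonal of $\lambda\setminus R$, and $R\cup S$ is skew-shifted. Its head is $H(R)$. A $k$-ribbon is a single or double ribbon with $k$ cells. A $k$-core is a shifted diagram with no removable $k$-ribbon. Standard tableaux. A standard shifted $k$-ribbon tableau of shape $\lambda$ is a chain $\lambda^{(0)}\subset\cdots\subset\lambda^{(n)}=\lambda$ such that $\lambda^{(0)}$ is a $k$-core and each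 $\lambda^{(i)}\setminus\lambda^{(i-1)}$ is a removable $k$-ribbon of $\lambda^{(i)}$, labelled $i$. Its reading word lists the labels of the heads of the ribbons row by row, from the top row to the bottom row, and from left to right within a row. $\mathrm{Des}(T)=\{i\in[n-1]: i+1 \text{ appears to the left of } i \text{ in the reading word}\}$. Marked standard tableaux. A marked standard shifted $k$-ribbon tableau $T'$ is a standard one $T$ together with a subset $M\subseteq[n]$, where the label $i$ is replaced by $i'$ for $i\in M$; the set of these is $\mathrm{Mark}(T)$. To define $\mathrm{Des}(T')$, form the word consisting of the marked labels in the reverse of their order in the reading word, followed by the unmarked labels in their order in the reading word, all marks being erased. Then $\mathrm{Des}(T')$ is the set of $i\in[n-1]$ such that $i+1$ appears to the left of $i$ in this word. Semi-standard tableaux. Horizontal (resp. vertical) $k$-ribbon strips $\lambda\setminus\lambda^{(0)}$ are given by chains $\lambda^{(0)}\subset\cdots\subset\lambda^{(t)}=\lambda$ of removable $k$-ribbon additions $R_i$ with $H(R_i)$ in a column strictly right of (resp. a row strictly above) $H(R_{i-1})$. A semi-standard shifted $k$-ribbon tableau is a chain $\lambda^{(0)}\subseteq\lambda^{(1')}\subseteq\lambda^{(1)}\subseteq\cdots\subseteq\lambda^{(m)}=\lambda$, with strip decompositions, such that: - $\lambda^{(0)}$ is a $k$-core; - $\lambda^{(i')}\setminus\lambda^{(i-1)}$ is a vertical strip, whose ribbons are labelled $i'$; - $\lambda^{(i)}\setminus\lambda^{(i')}$ is a horizontal strip, whose ribbons are labelled $i$. Then $RQ^{(k)}_\lambda(X)=\sum_S\prod_i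 x_i^{\#\{\text{ribbons labelled } i \text{ or } i'\}}$. Quasisymmetric functions. For $D\subseteq[n-1]$, $F_D(X)=\sum x_{i_1}\cdots x_{i_n}$, summed over $i_1\le\cdots\le i_n$ with $i_t<i_{t+1}$ whenever $t\in D$. Further: - $\mathrm{Peak}(D)=\{i\ge2: i\in D,\ i-1\notin D\}$; - $\mathrm{Spike}(D)=\{i\ge 2: \text{exactly one of } i,\ i-1 \text{ lies in } D\}$; - for such a set $P$, $G_P(X)=\sum_{D\subseteq[n-1],\ \mathrm{Spike}(D)\supseteq P}F_D(X)$.
   Formalization: The second equality is stated only when λ is not a k-core: for a k-core the only tableau is the trivial chain (n=0), so RQ=1 while the last sum is 2^{0+1}·G_∅=2. The first equality is stated for all strict λ. -}

module Defs where

open import Data.Nat using (ℕ; zero; suc; _+_; _*_; _∸_; _^_; _≡ᵇ_; _<ᵇ_; _≤ᵇ_)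
open import Data.Bool using (Bool; true; false; _∧_; _∨_; not; if_then_else_)
open import Data.List using (List; []; _∷_; _++_; map; length; filterᵇ;
  applyUpTo; concatMap; cartesianProduct; reverse; foldr)
open import Data.Bool.ListAction using (all; any)
open import Data.Nat.ListAction using (sum)
open import Data.Maybe using (Maybe; just; nothing)
open import Data.Product using (_×_; _,_; proj₁; proj₂)

from1 : ℕ → List ℕ
from1 n = applyUpTo suc n

listsOfLength : {A : Set} → ℕ → List A → List (List A)
listsOfLength zero    xs = [] ∷ []
listsOfLength (suc n) xs = concatMap (λ x → map (x ∷_) (listsOfLength n xs)) xs

sublists : {A : Set} → List A → List (List A)
sublists []       = [] ∷ []
sublists (x ∷ xs) = sublists xs ++ map (x ∷_) (sublists xs)

elemℕ : ℕ → List ℕ → Bool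
elemℕ x = any (x ≡ᵇ_)

countℕ : ℕ → List ℕ → ℕ
countℕ x ys = length (filterᵇ (x ≡ᵇ_) ys)

allDistinct : List ℕ → Bool
allDistinct []       = true
allDistinct (x ∷ xs) = not (elemℕ x xs) ∧ allDistinct xs

-- position (0-based) of x in a list (length of the list if absent)
posℕ : ℕ → List ℕ → ℕ
posℕ x []       = zero
posℕ x (y ∷ ys) = if x ≡ᵇ y then zero else suc (posℕ x ys)

-- Cells and shifted diagrams (French convention, rows numbered from 1
-- at the bottom).  A cell is (c , r) = (column , row).

Cell : Set
Cell = ℕ × ℕ

col row : Cell → ℕ
col = proj₁
row = proj₂

cellEq : Cell → Cell → Bool
cellEq (a , b) (c , d) = (a ≡ᵇ c) ∧ (b ≡ᵇ d)

elemC : Cell → List Cell → Bool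
elemC x = any (cellEq x)

subsetC : List Cell → List Cell → Bool
subsetC xs ys = all (λ x → elemC x ys) xs

sameSet : List Cell → List Cell → Bool
sameSet xs ys = subsetC xs ys ∧ subsetC ys xs

minusC : List Cell → List Cell → List Cell
minusC xs ys = filterᵇ (λ x → not (elemC x ys)) xs

diagVal : Cell → ℕ
diagVal (c , r) = suc (c ∸ r)

Part : Set
Part = List ℕ

isStrictPartition : Part → Bool
isStrictPartition []           = true
isStrictPartition (x ∷ [])     = 0 <ᵇ x
isStrictPartition (x ∷ y ∷ ys) = (y <ᵇ x) ∧ isStrictPartition (y ∷ ys)

cellsFrom : ℕ → Part → List Cell
cellsFrom r []       = []
cellsFrom r (l ∷ ls) = applyUpTo (λ j → (r + j , r)) l ++ cellsFrom (suc r) ls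

cells : Part → List Cell
cells = cellsFrom 1

strictUpTo : ℕ → List Part
strictUpTo zero    = [] ∷ []
strictUpTo (suc N) = strictUpTo N ++ map (suc N ∷_) (strictUpTo N)

firstPart : Part → ℕ
firstPart []      = 0
firstPart (x ∷ _) = x

subparts : Part → List Part
subparts la = filterᵇ (λ mu → subsetC (cells mu) (cells la)) (strictUpTo (firstPart la))

maxCol : List Cell → ℕ
maxCol = foldr (λ x m → if m <ᵇ col x then col x else m) 0

-- skew-shifted diagram: X = ν ∖ μ (as sets) for shifted diagrams μ ⊆ ν.
-- It suffices to search ν, μ with parts ≤ the largest column of X
-- (every row of the smallest such ν, the down-closure of X, is that short).
isSkewShifted : List Cell → Bool
isSkewShifted X =
  any (λ nu → any (λ mu → subsetC (cells mu) (cells nu)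
                         ∧ sameSet X (minusC (cells nu) (cells mu)))
                  (strictUpTo (maxCol X)))
      (strictUpTo (maxCol X))

adjacent : Cell → Cell → Bool
adjacent (a , b) (c , d) =
  ((b ≡ᵇ d) ∧ ((suc a ≡ᵇ c) ∨ (suc c ≡ᵇ a))) ∨
  ((a ≡ᵇ c) ∧ ((suc b ≡ᵇ d) ∨ (suc d ≡ᵇ b)))

growIn : List Cell → List Cell → List Cell
growIn X S = filterᵇ (λ x → elemC x S ∨ any (adjacent x) S) X

iterGrow : ℕ → List Cell → List Cell → List Cell
iterGrow zero    X S = S
iterGrow (suc n) X S = iterGrow n X (growIn X S)

edgeConnected : List Cell → Bool
edgeConnected []       = false
edgeConnected (x ∷ xs) =
  subsetC (x ∷ xs) (iterGrow (length (x ∷ xs)) (x ∷ xs) (x ∷ []))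

isSingleRibbon : List Cell → Bool
isSingleRibbon X = edgeConnected X ∧ isSkewShifted X ∧ allDistinct (map diagVal X)

headC : List Cell → Cell
headC []       = (0 , 0)
headC (x ∷ xs) = foldr (λ y m → if diagVal m <ᵇ diagVal y then y else m) x xs

tailC : List Cell → Cell
tailC []       = (0 , 0)
tailC (x ∷ xs) = foldr (λ y m → if diagVal y <ᵇ diagVal m then y else m) x xs

-- (R , S) with X = R ∪ S (disjoint) is a double ribbon decomposition in λ
isDoubleDecomp : List Cell → List Cell → List Cell → List Cell → Bool
isDoubleDecomp L X R S =
  isSingleRibbon R ∧ isSingleRibbon S ∧ (length S ≤ᵇ length R)
  ∧ elemC (tailC R) L ∧ (diagVal (tailC R) ≡ᵇ 1)
  ∧ elemC (tailC S) (minusC L R) ∧ (diagVal (tailC S) ≡ᵇ 1)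
  ∧ isSkewShifted X

doubleHeads : List Cell → List Cell → List Cell
doubleHeads L X =
  map headC (filterᵇ (λ R → isDoubleDecomp L X R (minusC X R)) (sublists X))

ribbonHead : ℕ → List Cell → List Cell → Maybe Cell
ribbonHead k L X with length X ≡ᵇ k | isSingleRibbon X | doubleHeads L X
... | false | _    | _      = nothing
... | true  | true | _      = just (headC X)
... | true  | false | []    = nothing
... | true  | false | h ∷ _ = just h

stepHead : ℕ → Part → Part → Maybe Cell
stepHead k mu la =
  if subsetC (cells mu) (cells la)
  then ribbonHead k (cells la) (minusC (cells la) (cells mu))
  else nothing

isJust : {A : Set} → Maybe A → Bool
isJust (just _) = true
isJust nothing  = false

isCore : ℕ → Part → Bool
isCore k la = all (λ mu → not (isJust (stepHead k mu la))) (subparts la)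

-- Standard shifted k-ribbon tableaux, as chains λ^(0) ⊂ ... ⊂ λ^(n) = λ
-- stored as the list (λ^(0) ∷ λ^(1) ∷ ... ∷ λ^(n) ∷ []).

Chain : Set
Chain = List Part

lastPart : Part → List Part → Part
lastPart p []       = p
lastPart p (q ∷ qs) = lastPart q qs

validSteps : ℕ → Part → List Part → Bool
validSteps k p []       = true
validSteps k p (q ∷ qs) = isJust (stepHead k p q) ∧ validSteps k q qs

isStdTableau : ℕ → Part → Chain → Bool
isStdTableau k la []       = false
isStdTableau k la (p ∷ ps) =
  isStrictPartition la ∧ isCore k p ∧ validSteps k p ps
  ∧ (isStrictPartition (lastPart p ps) ∧ subsetC (cells (lastPart p ps)) (cells la)
     ∧ subsetC (cells la) (cells (lastPart p ps)))

-- every standard tableau has n ≤ |λ| and all λ^(i) ⊆ λ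
stdTableaux : ℕ → Part → List Chain
stdTableaux k la =
  filterᵇ (isStdTableau k la)
    (concatMap (λ n → listsOfLength (suc n) (subparts la)) (applyUpTo (λ i → i) (suc (sum la))))

size : Chain → ℕ
size ch = length ch ∸ 1

fromMaybeC : Maybe Cell → Cell
fromMaybeC (just x) = x
fromMaybeC nothing  = (0 , 0)

headsFrom : ℕ → Part → List Part → List Cell
headsFrom k p []       = []
headsFrom k p (q ∷ qs) = fromMaybeC (stepHead k p q) ∷ headsFrom k q qs

heads : ℕ → Chain → List Cell
heads k []       = []
heads k (p ∷ ps) = headsFrom k p ps

-- head of the ribbon labelled i (1-based)
nth : List Cell → ℕ → Cell
nth []       _       = (0 , 0)
nth (x ∷ xs) (suc zero) = x
nth (x ∷ xs) zero    = (0 , 0)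
nth (x ∷ xs) (suc (suc i)) = nth xs (suc i)

readsBefore : Cell → Cell → Bool
readsBefore (a , b) (c , d) = (d <ᵇ b) ∨ ((b ≡ᵇ d) ∧ (a <ᵇ c))

insertBy : (ℕ → ℕ → Bool) → ℕ → List ℕ → List ℕ
insertBy lt x []       = x ∷ []
insertBy lt x (y ∷ ys) = if lt x y then x ∷ y ∷ ys else y ∷ insertBy lt x ys

sortBy : (ℕ → ℕ → Bool) → List ℕ → List ℕ
sortBy lt = foldr (insertBy lt) []

readingWord : ℕ → Chain → List ℕ
readingWord k ch =
  sortBy (λ i j → readsBefore (nth (heads k ch) i) (nth (heads k ch) j)) (from1 (size ch))

-- descent set of a word in which every label 1..n occurs:
-- {i ∈ [n-1] : i+1 appears to the left of i}
wordDes : ℕ → List ℕ → List ℕ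
wordDes n w = filterᵇ (λ i → posℕ (suc i) w <ᵇ posℕ i w) (from1 (n ∸ 1))

Des : ℕ → Chain → List ℕ
Des k ch = wordDes (size ch) (readingWord k ch)

-- Marked standard tableaux: (T , M) with M ⊆ [n]

Marked : Set
Marked = Chain × List ℕ

markedTableaux : ℕ → Part → List Marked
markedTableaux k la =
  concatMap (λ ch → map (λ M → (ch , M)) (sublists (from1 (size ch)))) (stdTableaux k la)

markedWord : ℕ → Marked → List ℕ
markedWord k (ch , M) =
  reverse (filterᵇ (λ i → elemℕ i M) (readingWord k ch))
  ++ filterᵇ (λ i → not (elemℕ i M)) (readingWord k ch)

DesMarked : ℕ → Marked → List ℕ
DesMarked k (ch , M) = wordDes (size ch) (markedWord k (ch , M))

-- Quasisymmetric functions, coefficient-wise.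
-- A monomial x_1^{α_1} ⋯ x_m^{α_m} is given by α : List ℕ.

weaklyIncreasing : List ℕ → Bool
weaklyIncreasing []           = true
weaklyIncreasing (x ∷ [])     = true
weaklyIncreasing (x ∷ y ∷ ys) = (x ≤ᵇ y) ∧ weaklyIncreasing (y ∷ ys)

-- the entry i_t (1-based t)
nthℕ : List ℕ → ℕ → ℕ
nthℕ []       _             = 0
nthℕ (x ∷ xs) zero          = 0
nthℕ (x ∷ xs) (suc zero)    = x
nthℕ (x ∷ xs) (suc (suc t)) = nthℕ xs (suc t)

hasContent : List ℕ → List ℕ → Bool
hasContent α seq =
  all (λ j → countℕ j seq ≡ᵇ nthℕ α j) (from1 (length α))
  ∧ all (λ v → (1 ≤ᵇ v) ∧ (v ≤ᵇ length α)) seq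

Fcoef : ℕ → List ℕ → List ℕ → ℕ
Fcoef n D α =
  length (filterᵇ (λ s → weaklyIncreasing s
                        ∧ all (λ t → nthℕ s t <ᵇ nthℕ s (suc t)) D
                        ∧ hasContent α s)
                  (listsOfLength n (from1 (length α))))

Peak : List ℕ → List ℕ
Peak D = filterᵇ (λ i → (2 ≤ᵇ i) ∧ not (elemℕ (i ∸ 1) D)) D

-- Spike(D) for D ⊆ [n-1]: elements i ≥ 2 with exactly one of i, i-1 in D
-- (necessarily i ≤ n)
Spike : ℕ → List ℕ → List ℕ
Spike n D = filterᵇ (λ i → (2 ≤ᵇ i) ∧ (not (elemℕ i D ≡ᵇᴮ elemℕ (i ∸ 1) D))) (from1 n)
  where
  _≡ᵇᴮ_ : Bool → Bool → Bool
  true  ≡ᵇᴮ b = b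
  false ≡ᵇᴮ b = not b

Gcoef : ℕ → List ℕ → List ℕ → ℕ
Gcoef n P α =
  sum (map (λ D → Fcoef n D α)
       (filterᵇ (λ D → all (λ p → elemℕ p (Spike n D)) P) (sublists (from1 (n ∸ 1)))))

-- Semi-standard shifted k-ribbon tableaux.
-- Such a tableau (with its strip decompositions) is a k-core μ together with
-- the sequence of single ribbon additions, each carrying its label; labels are
-- coded by naturals: j' ↦ 2j-1 and j ↦ 2j, so that the order
-- 1' < 1 < 2' < 2 < ⋯ is the order of codes.  Labels must weakly increase
-- along the sequence; two consecutive ribbons with the same label j'
-- (resp. j) belong to the same vertical (resp. horizontal) strip, so the head
-- of the later one lies in a row strictly above (resp. column strictly right
-- of) the head of the earlier one.

isOdd : ℕ → Bool
isOdd zero          = false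
isOdd (suc zero)    = true
isOdd (suc (suc n)) = isOdd n

stripCompat : Maybe (ℕ × Cell) → ℕ → Cell → Bool
stripCompat nothing           c h = true
stripCompat (just (c0 , h0)) c h =
  (c0 <ᵇ c) ∨ ((c0 ≡ᵇ c) ∧ (if isOdd c then row h0 <ᵇ row h else col h0 <ᵇ col h))

ssSteps : ℕ → ℕ → Part → Maybe (ℕ × Cell) → List (Part × ℕ) → Bool
ssSteps k m p prev []              = true
ssSteps k m p prev ((q , c) ∷ qs) =
  isJust (stepHead k p q) ∧ (1 ≤ᵇ c) ∧ (c ≤ᵇ 2 * m)
  ∧ stripCompat prev c (fromMaybeC (stepHead k p q))
  ∧ ssSteps k m q (just (c , fromMaybeC (stepHead k p q))) qs

lastPartL : Part → List (Part × ℕ) → Part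
lastPartL p []             = p
lastPartL p ((q , _) ∷ qs) = lastPartL q qs

ssContent : List ℕ → List (Part × ℕ) → Bool
ssContent α steps =
  all (λ j → length (filterᵇ (λ s → (proj₂ s ≡ᵇ (2 * j ∸ 1)) ∨ (proj₂ s ≡ᵇ 2 * j)) steps)
             ≡ᵇ nthℕ α j)
      (from1 (length α))

isSSTableau : ℕ → Part → List ℕ → Part × List (Part × ℕ) → Bool
isSSTableau k la α (mu0 , steps) =
  isStrictPartition la ∧ isCore k mu0 ∧ ssSteps k (length α) mu0 nothing steps
  ∧ isStrictPartition (lastPartL mu0 steps)
  ∧ sameSet (cells (lastPartL mu0 steps)) (cells la)
  ∧ ssContent α steps

-- coefficient of x^α in RQ^(k)_λ: the number of semi-standard shifted
-- k-ribbon tableaux of shape λ, with labels in {1',1,…,m',m} (m = length α),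
-- having exactly α_j ribbons labelled j or j'.  (All intermediate shapes lie
-- inside λ and there are at most |λ| ribbons.)
RQcoef : ℕ → Part → List ℕ → ℕ
RQcoef k la α =
  length (filterᵇ (isSSTableau k la α)
    (concatMap (λ mu0 → concatMap (λ t → map (λ st → (mu0 , st))
                 (listsOfLength t (cartesianProduct (subparts la) (from1 (2 * length α)))))
               (applyUpTo (λ i → i) (suc (sum la))))
       (subparts la)))

{-# OPTIONS --safe #-}
module Submission where

-- Forgetting the labels of a semi-standard tableau leaves a chain of shapes, so all three sides are
-- compared chain by chain. In two consecutive ribbon additions the second head lies either
-- strictly to the right of the first or strictly above it, never both, because a head has the largest
-- diagonal value of its ribbon. The strip conditions on two equal labels therefore say exactly that
-- i is not a descent of the marked tableau, and reading off marks and values from the labels gives the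
-- first equality. For the second, the marks of i and i + 1 decide whether i is a marked descent:
-- at a descent i of T it is one iff i is unmarked, at a non-descent iff i + 1 is marked. A
-- prescribed set E of marked descents thus fixes the mark of each i ∈ Des(T), and of i + 1 for each
-- other i; only a peak is fixed twice, consistently iff it is a spike of E, and 1 + #peaks marks stay free.

open import Defs
open import Algebra.Properties.CommutativeSemigroup using (interchange)
open import Data.Bool using (Bool; true; false; T; T?; not; _∧_; _∨_; _xor_; if_then_else_)
open import Data.Bool.ListAction using (all; any)
open import Data.Bool.Properties using (T-∧; T-∨; T-≡; T-not-≡; ∧-zeroʳ; ∧-identityʳ; ∨-identityʳ; ∧-assoc)
open import Data.Empty using (⊥-elim)
open import Data.List using (List; []; _∷_; _++_; map; length; concatMap; filterᵇ; applyUpTo; zipWith; reverse; cartesianProduct)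
open import Data.List.Membership.Propositional using (_∈_; _∉_)
open import Data.List.Membership.Propositional.Properties
  using (∈-map⁺; ∈-map⁻; ∈-++⁺ˡ; ∈-++⁺ʳ; ∈-++⁻; ∈-∃++; ∈-filter⁺; ∈-filter⁻; ∈-applyUpTo⁺; ∈-applyUpTo⁻)
open import Data.List.Properties using (map-++; map-∘; length-map; length-applyUpTo; length-zipWith; unfold-reverse)
open import Data.List.Relation.Unary.All as All using (All; []; _∷_)
open import Data.List.Relation.Unary.AllPairs using (AllPairs; []; _∷_)
import Data.List.Relation.Unary.AllPairs.Properties as AllPairs
open import Data.List.Relation.Unary.Any using (here; there)
open import Data.List.Relation.Unary.Any.Properties using (reverse⁺; reverse⁻)
open import Data.List.Relation.Unary.Linked using (Linked; []; [-]; _∷_)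
open import Data.List.Relation.Unary.Unique.Propositional using (Unique)
open import Data.Maybe using (Maybe; just; nothing)
open import Data.Nat using (ℕ; zero; suc; _+_; _*_; _∸_; _^_; _≤_; _<_; _≡ᵇ_; _<ᵇ_; _≤ᵇ_; _⊓_; z≤n; s≤s)
open import Data.Nat.ListAction using (sum)
open import Data.Nat.ListAction.Properties using (sum-++)
open import Data.Nat.Properties
open import Data.Product using (_×_; _,_; proj₁; proj₂; ∃)
open import Data.Sum using (_⊎_; inj₁; inj₂)
open import Data.Unit using (tt)
open import Function using (_∘_; flip)
open import Function.Bundles using (Equivalence)
open import Relation.Binary.PropositionalEquality
  using (_≡_; _≢_; refl; sym; trans; cong; cong₂; subst; subst₂; module ≡-Reasoning)
open import Relation.Nullary using (¬_; contradiction; yes; no)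

-- Sums over lists and the enumerations of Defs

-- The peak formula is proved for λ that is not a k-core. For a k-core the only standard tableau has
-- n = 0 and just the empty marking, so the marked sum is 1, while the exponent 1 + #peaks would
-- give 2. For n ≥ 1 the exponent arises as follows: each of the n - 1 positions fixes one of the n
-- marks, and the mark of a peak i is fixed by both positions i - 1 and i, so n - 1 - #peaks marks
-- are fixed in all.
--
-- Markings, descent sets and the sets E are handled as Boolean words, which turns the count of
-- markings into an induction along the descent word of T. In that induction F_E is replaced by an
-- arbitrary weight, because only the number of markings that produce each E is at stake.
--
-- Two heads are compared only when their labels are consecutive. This suffices, since descents,
-- strip conditions and marked descents all concern neighbouring labels.

∑ : {A : Set} → List A → (A → ℕ) → ℕ
∑ xs f = sum (map f xs)

⟦_⟧ : Bool → ℕ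
⟦ b ⟧ = if b then 1 else 0

module _ {A : Set} where

  ∑-cong : {f g : A → ℕ} (xs : List A) → (∀ {x} → x ∈ xs → f x ≡ g x) → ∑ xs f ≡ ∑ xs g
  ∑-cong []       eq = refl
  ∑-cong (x ∷ xs) eq = cong₂ _+_ (eq (here refl)) (∑-cong xs (eq ∘ there))

  ∑-ext : {f g : A → ℕ} (xs : List A) → (∀ x → f x ≡ g x) → ∑ xs f ≡ ∑ xs g
  ∑-ext xs eq = ∑-cong xs (λ {x} _ → eq x)

  ∑-++ : {f : A → ℕ} (xs ys : List A) → ∑ (xs ++ ys) f ≡ ∑ xs f + ∑ ys f
  ∑-++ {f} xs ys = trans (cong sum (map-++ f xs ys)) (sum-++ (map f xs) (map f ys))

  ∑-map : {B : Set} {f : A → ℕ} {h : B → A} (xs : List B) → ∑ (map h xs) f ≡ ∑ xs (f ∘ h)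
  ∑-map xs = cong sum (sym (map-∘ xs))

  ∑-concatMap : {B : Set} {f : A → ℕ} (h : B → List A) (xs : List B) →
    ∑ (concatMap h xs) f ≡ ∑ xs (λ x → ∑ (h x) f)
  ∑-concatMap h []       = refl
  ∑-concatMap h (x ∷ xs) = trans (∑-++ (h x) _) (cong (∑ (h x) _ +_) (∑-concatMap h xs))

  ∑-filterᵇ : {f : A → ℕ} (p : A → Bool) (xs : List A) →
    ∑ (filterᵇ p xs) f ≡ ∑ xs (λ x → if p x then f x else 0)
  ∑-filterᵇ p []       = refl
  ∑-filterᵇ {f} p (x ∷ xs) with p x
  ... | true  = cong (f x +_) (∑-filterᵇ p xs)
  ... | false = ∑-filterᵇ p xs

  length-filterᵇ : (p : A → Bool) (xs : List A) → length (filterᵇ p xs) ≡ ∑ xs (λ x → ⟦ p x ⟧)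
  length-filterᵇ p []       = refl
  length-filterᵇ p (x ∷ xs) with p x
  ... | true  = cong suc (length-filterᵇ p xs)
  ... | false = length-filterᵇ p xs

  ∑-+ : {f g : A → ℕ} (xs : List A) → ∑ xs (λ x → f x + g x) ≡ ∑ xs f + ∑ xs g
  ∑-+ []       = refl
  ∑-+ {f} {g} (x ∷ xs) = trans (cong (f x + g x +_) (∑-+ xs)) (interchange +-commutativeSemigroup (f x) (g x) _ _)

  ∑-0 : (xs : List A) → ∑ xs (λ _ → 0) ≡ 0
  ∑-0 []       = refl
  ∑-0 (x ∷ xs) = ∑-0 xs

∑-swap : {A B : Set} {f : A → B → ℕ} (xs : List A) (ys : List B) →
  ∑ xs (λ x → ∑ ys (f x)) ≡ ∑ ys (λ y → ∑ xs (λ x → f x y))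
∑-swap []       ys = sym (∑-0 ys)
∑-swap {f = f} (x ∷ xs) ys = trans (cong (∑ ys (f x) +_) (∑-swap xs ys)) (sym (∑-+ ys))

module _ {A : Set} where

  ∑-listsOfLength-suc : {f : List A → ℕ} (n : ℕ) (xs : List A) →
    ∑ (listsOfLength (suc n) xs) f ≡ ∑ xs (λ x → ∑ (listsOfLength n xs) (λ l → f (x ∷ l)))
  ∑-listsOfLength-suc n xs =
    trans (∑-concatMap _ xs) (∑-ext xs (λ x → ∑-map (listsOfLength n xs)))

  ∈-listsOfLength⁻ : (n : ℕ) (xs : List A) {l : List A} → l ∈ listsOfLength n xs →
    length l ≡ n × All (_∈ xs) l
  ∈-listsOfLength⁻ zero    xs (here refl) = refl , []
  ∈-listsOfLength⁻ (suc n) xs l∈ = go (∈-concatMap-∃ xs l∈)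
    where
    ∈-concatMap-∃ : ∀ ys {l} → l ∈ concatMap (λ x → map (x ∷_) (listsOfLength n xs)) ys →
      ∃ λ x → x ∈ ys × l ∈ map (x ∷_) (listsOfLength n xs)
    ∈-concatMap-∃ (y ∷ ys) l∈ with ∈-++⁻ (map (y ∷_) (listsOfLength n xs)) l∈
    ... | inj₁ l∈y = y , here refl , l∈y
    ... | inj₂ l∈r with ∈-concatMap-∃ ys l∈r
    ... | x , x∈ , q = x , there x∈ , q
    go : ∀ {l} → (∃ λ x → x ∈ xs × l ∈ map (x ∷_) (listsOfLength n xs)) → length l ≡ suc n × All (_∈ xs) l
    go (x , x∈ , q) with ∈-map⁻ (x ∷_) q
    ... | l′ , l′∈ , refl with ∈-listsOfLength⁻ n xs l′∈
    ... | len , al = cong suc len , x∈ ∷ al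

-- Separates shapes from label codes, and then label codes into values and marks. In each step of
-- the induction, the sum over the second component of the first letter is swapped past the sum over
-- the first components of the others.
∑-listsOfLength-zipWith : {A B C : Set} (g : A → B → C) (zs : List C) (xs : List A) (ys : List B) →
  (∀ F → ∑ zs F ≡ ∑ xs (λ x → ∑ ys (λ y → F (g x y)))) → (n : ℕ) (f : List C → ℕ) →
  ∑ (listsOfLength n zs) f ≡
  ∑ (listsOfLength n xs) (λ a → ∑ (listsOfLength n ys) (λ b → f (zipWith g a b)))
∑-listsOfLength-zipWith g zs xs ys base zero    f = sym (+-identityʳ _)
∑-listsOfLength-zipWith g zs xs ys base (suc n) f = begin
  ∑ (listsOfLength (suc n) zs) f
    ≡⟨ ∑-listsOfLength-suc n zs ⟩
  ∑ zs (λ z → ∑ (listsOfLength n zs) (λ l → f (z ∷ l)))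
    ≡⟨ ∑-ext zs (λ z → ∑-listsOfLength-zipWith g zs xs ys base n (λ l → f (z ∷ l))) ⟩
  ∑ zs (λ z → ∑ (listsOfLength n xs) (λ a → ∑ (listsOfLength n ys) (λ b → f (z ∷ zipWith g a b))))
    ≡⟨ base _ ⟩
  ∑ xs (λ x → ∑ ys (λ y → ∑ (listsOfLength n xs) (λ a → ∑ (listsOfLength n ys) (λ b → f (g x y ∷ zipWith g a b)))))
    ≡⟨ ∑-ext xs (λ x → ∑-swap ys (listsOfLength n xs)) ⟩
  ∑ xs (λ x → ∑ (listsOfLength n xs) (λ a → ∑ ys (λ y → ∑ (listsOfLength n ys) (λ b → f (g x y ∷ zipWith g a b)))))
    ≡⟨ ∑-ext xs (λ x → ∑-ext (listsOfLength n xs) (λ a → ∑-listsOfLength-suc n ys)) ⟨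
  ∑ xs (λ x → ∑ (listsOfLength n xs) (λ a → ∑ (listsOfLength (suc n) ys) (λ b → f (zipWith g (x ∷ a) b))))
    ≡⟨ ∑-listsOfLength-suc n xs ⟨
  ∑ (listsOfLength (suc n) xs) (λ a → ∑ (listsOfLength (suc n) ys) (λ b → f (zipWith g a b))) ∎
  where open ≡-Reasoning

∑-cartesianProduct : {A B : Set} {f : A × B → ℕ} (xs : List A) (ys : List B) →
  ∑ (cartesianProduct xs ys) f ≡ ∑ xs (λ x → ∑ ys (λ y → f (x , y)))
∑-cartesianProduct []       ys = refl
∑-cartesianProduct (x ∷ xs) ys =
  trans (∑-++ (map (x ,_) ys) _) (cong₂ _+_ (∑-map ys) (∑-cartesianProduct xs ys))

-- `from1` shifts the function inside `applyUpTo`; a variable starting point permits inductions that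
-- peel off the first element.
range : ℕ → ℕ → List ℕ
range j zero    = []
range j (suc n) = j ∷ range (suc j) n

applyUpTo-cong : {A : Set} {f g : ℕ → A} → (∀ i → f i ≡ g i) → (n : ℕ) → applyUpTo f n ≡ applyUpTo g n
applyUpTo-cong eq zero    = refl
applyUpTo-cong eq (suc n) = cong₂ _∷_ (eq 0) (applyUpTo-cong (eq ∘ suc) n)

from1≡range : (n : ℕ) → from1 n ≡ range 1 n
from1≡range = go 1
  where
  go : ∀ j n → applyUpTo (j +_) n ≡ range j n
  go j zero    = refl
  go j (suc n) = cong₂ _∷_ (+-identityʳ j) (trans (applyUpTo-cong (+-suc j) n) (go (suc j) n))

bools : List Bool
bools = false ∷ true ∷ []

-- The subset with a given characteristic word, place i of the word standing for the number j + i.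
indices : ℕ → List Bool → List ℕ
indices j []          = []
indices j (true  ∷ b) = j ∷ indices (suc j) b
indices j (false ∷ b) = indices (suc j) b

∑-sublists-range : {f : List ℕ → ℕ} (j n : ℕ) →
  ∑ (sublists (range j n)) f ≡ ∑ (listsOfLength n bools) (λ b → f (indices j b))
∑-sublists-range j zero    = refl
∑-sublists-range {f} j (suc n) = begin
  ∑ (sublists (range j (suc n))) f
    ≡⟨ ∑-++ (sublists (range (suc j) n)) _ ⟩
  ∑ (sublists (range (suc j) n)) f + ∑ (map (j ∷_) (sublists (range (suc j) n))) f
    ≡⟨ cong₂ _+_ (∑-sublists-range (suc j) n)
                 (trans (∑-map (sublists (range (suc j) n))) (∑-sublists-range (suc j) n)) ⟩
  X + Y
    ≡⟨ cong (X +_) (+-identityʳ Y) ⟨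
  X + (Y + 0)
    ≡⟨ ∑-listsOfLength-suc n bools ⟨
  ∑ (listsOfLength (suc n) bools) (λ b → f (indices j b)) ∎
  where
  open ≡-Reasoning
  X Y : ℕ
  X = ∑ (listsOfLength n bools) (λ b → f (indices (suc j) b))
  Y = ∑ (listsOfLength n bools) (λ b → f (j ∷ indices (suc j) b))

∑-sublists-from1 : {f : List ℕ → ℕ} (n : ℕ) →
  ∑ (sublists (from1 n)) f ≡ ∑ (listsOfLength n bools) (λ b → f (indices 1 b))
∑-sublists-from1 {f} n = trans (cong (λ l → ∑ (sublists l) f) (from1≡range n)) (∑-sublists-range 1 n)

-- Characteristic words of subsets

bit : List Bool → ℕ → Bool
bit []      _       = false
bit (b ∷ _) zero    = b
bit (_ ∷ b) (suc i) = bit b i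

bit⇒< : ∀ b i → T (bit b i) → i < length b
bit⇒< (_ ∷ _) zero    _ = s≤s z≤n
bit⇒< (_ ∷ b) (suc i) t = s≤s (bit⇒< b i t)

≡ᵇ-refl : ∀ n → (n ≡ᵇ n) ≡ true
≡ᵇ-refl zero    = refl
≡ᵇ-refl (suc n) = ≡ᵇ-refl n

<⇒≡ᵇ-false : ∀ {m n} → m < n → (m ≡ᵇ n) ≡ false
<⇒≡ᵇ-false {zero}  (s≤s _)   = refl
<⇒≡ᵇ-false {suc m} (s≤s m<n) = <⇒≡ᵇ-false m<n

≡ᵇ-sym : ∀ m n → (m ≡ᵇ n) ≡ (n ≡ᵇ m)
≡ᵇ-sym zero    zero    = refl
≡ᵇ-sym zero    (suc n) = refl
≡ᵇ-sym (suc m) zero    = refl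
≡ᵇ-sym (suc m) (suc n) = ≡ᵇ-sym m n

elemℕ-indices-< : ∀ {i j} → i < j → ∀ b → elemℕ i (indices j b) ≡ false
elemℕ-indices-< i<j []          = refl
elemℕ-indices-< i<j (true  ∷ b) rewrite <⇒≡ᵇ-false i<j = elemℕ-indices-< (m<n⇒m<1+n i<j) b
elemℕ-indices-< i<j (false ∷ b) = elemℕ-indices-< (m<n⇒m<1+n i<j) b

elemℕ-indices : ∀ j i b → elemℕ (j + i) (indices j b) ≡ bit b i
elemℕ-indices j i       []          = refl
elemℕ-indices j zero    (true  ∷ b) rewrite +-identityʳ j | ≡ᵇ-refl j = refl
elemℕ-indices j zero    (false ∷ b) rewrite +-identityʳ j = elemℕ-indices-< ≤-refl b
elemℕ-indices j (suc i) (true  ∷ b)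
  rewrite +-suc j i | ≡ᵇ-sym (suc (j + i)) j | <⇒≡ᵇ-false {j} {suc (j + i)} (s≤s (m≤m+n j i)) = elemℕ-indices (suc j) i b
elemℕ-indices j (suc i) (false ∷ b) rewrite +-suc j i = elemℕ-indices (suc j) i b

elemℕ-filterᵇ : ∀ x q ys → elemℕ x (filterᵇ q ys) ≡ elemℕ x ys ∧ q x
elemℕ-filterᵇ x q []       = refl
elemℕ-filterᵇ x q (y ∷ ys) with x ≡ᵇ y in eq
elemℕ-filterᵇ x q (y ∷ ys) | true with ≡ᵇ⇒≡ x y (subst T (sym eq) tt)
elemℕ-filterᵇ x q (x ∷ ys) | true | refl with q x in qx
... | true  rewrite eq = refl
... | false = trans (elemℕ-filterᵇ x q ys) (trans (cong (elemℕ x ys ∧_) qx) (∧-zeroʳ (elemℕ x ys)))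
elemℕ-filterᵇ x q (y ∷ ys) | false with q y
... | true  rewrite eq = elemℕ-filterᵇ x q ys
... | false = elemℕ-filterᵇ x q ys

filterᵇ-indices : ∀ q j b c → length c ≡ length b →
  (∀ i → bit c i ≡ bit b i ∧ q (j + i)) → filterᵇ q (indices j b) ≡ indices j c
filterᵇ-indices q j []      []      _   eq = refl
filterᵇ-indices q j (x ∷ b) (y ∷ c) len eq
  with eq 0 | filterᵇ-indices q (suc j) b c (suc-injective len) (λ i → trans (eq (suc i)) (cong (λ z → bit b i ∧ q z) (+-suc j i)))
filterᵇ-indices q j (false ∷ b) (.false ∷ c) len eq | refl | ih = ih
filterᵇ-indices q j (true  ∷ b) (y      ∷ c) len eq | e0   | ih rewrite +-identityʳ j with q j
filterᵇ-indices q j (true  ∷ b) (.true  ∷ c) len eq | refl | ih | true  = cong (j ∷_) ih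
filterᵇ-indices q j (true  ∷ b) (.false ∷ c) len eq | refl | ih | false = ih

bit-all : ∀ n i → i < n → bit (applyUpTo (λ _ → true) n) i ≡ true
bit-all (suc n) zero    _         = refl
bit-all (suc n) (suc i) (s≤s i<n) = bit-all n i i<n

range-indices : ∀ j n → range j n ≡ indices j (applyUpTo (λ _ → true) n)
range-indices j zero    = refl
range-indices j (suc n) = cong (j ∷_) (range-indices (suc j) n)

elemℕ-from1 : ∀ n i → i < n → elemℕ (suc i) (from1 n) ≡ true
elemℕ-from1 n i i<n rewrite from1≡range n | range-indices 1 n =
  trans (elemℕ-indices 1 i (applyUpTo (λ _ → true) n)) (bit-all n i i<n)

-- Counting markings

-- Membership of i in Des(T′), from the marks of i and i + 1 and from whether i ∈ Des(T).
markedDescent : Bool → Bool → Bool → Bool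
markedDescent m m′ d = if d then not m else m′

markedDescents : List Bool → List Bool → List Bool
markedDescents (m ∷ m′ ∷ ms) (d ∷ ds) = markedDescent m m′ d ∷ markedDescents (m′ ∷ ms) ds
markedDescents _             _        = []

-- The arguments p and q below are the letters preceding ds and es; taking p = true
-- keeps the first letter of ds from being a peak.
peakWord : Bool → List Bool → List Bool
peakWord p []       = []
peakWord p (d ∷ ds) = (d ∧ not p) ∷ peakWord d ds

spikesCover : Bool → Bool → List Bool → List Bool → Bool
spikesCover p q (d ∷ ds) (e ∷ es) = (not (d ∧ not p) ∨ (e xor q)) ∧ spikesCover d e ds es
spikesCover _ _ _        _        = true

count : List Bool → ℕ
count []       = 0
count (b ∷ bs) = ⟦ b ⟧ + count bs

-- One mark more than letters in `ds`: n ribbons have n - 1 possible descents.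
∑marks : List Bool → (List Bool → ℕ) → ℕ
∑marks ds Φ = ∑ (listsOfLength (suc (length ds)) bools) (λ m → Φ (markedDescents m ds))

∑marksFrom : Bool → List Bool → (List Bool → ℕ) → ℕ
∑marksFrom m ds Φ = ∑ (listsOfLength (length ds) bools) (λ ms → Φ (markedDescents (m ∷ ms) ds))

-- For p = true this is G at the peaks of `ds`, with the weight Φ in place of F.
∑covers : Bool → Bool → List Bool → (List Bool → ℕ) → ℕ
∑covers p q ds Φ = ∑ (listsOfLength (length ds) bools) (λ es → if spikesCover p q ds es then Φ es else 0)

∑bools : (f : Bool → ℕ) → ∑ bools f ≡ f false + f true
∑bools f = cong (f false +_) (+-identityʳ _)

∑-listsOfLength-bools : (n : ℕ) (f : List Bool → ℕ) → ∑ (listsOfLength (suc n) bools) f ≡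
  ∑ (listsOfLength n bools) (λ l → f (false ∷ l)) + ∑ (listsOfLength n bools) (λ l → f (true ∷ l))
∑-listsOfLength-bools n f = trans (∑-listsOfLength-suc n bools) (∑bools (λ x → ∑ (listsOfLength n bools) (λ l → f (x ∷ l))))

∑marks-split : ∀ ds Φ → ∑marks ds Φ ≡ ∑marksFrom false ds Φ + ∑marksFrom true ds Φ
∑marks-split ds Φ = ∑-listsOfLength-bools (length ds) _

-- At a descent the letter is decided by the mark at that place, and the next mark stays free.
∑marksFrom-true : ∀ m ds Φ → ∑marksFrom m (true ∷ ds) Φ ≡ ∑marks ds (Φ ∘ (not m ∷_))
∑marksFrom-true m ds Φ = trans (∑-listsOfLength-bools (length ds) _) (sym (∑marks-split ds (Φ ∘ (not m ∷_))))

-- At a non-descent the letter copies the next mark, so the right-hand side does not involve m.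
∑marksFrom-false : ∀ m ds Φ → ∑marksFrom m (false ∷ ds) Φ ≡
  ∑marksFrom false ds (Φ ∘ (false ∷_)) + ∑marksFrom true ds (Φ ∘ (true ∷_))
∑marksFrom-false m ds Φ = ∑-listsOfLength-bools (length ds) _

double : ∀ n → 2 * n ≡ n + n
double n = cong (n +_) (+-identityʳ n)

∑marks-false : ∀ ds Φ → ∑marks (false ∷ ds) Φ ≡
  2 * (∑marksFrom false ds (Φ ∘ (false ∷_)) + ∑marksFrom true ds (Φ ∘ (true ∷_)))
∑marks-false ds Φ = trans (∑marks-split (false ∷ ds) Φ)
  (trans (cong₂ _+_ (∑marksFrom-false false ds Φ) (∑marksFrom-false true ds Φ))
    (sym (double (∑marksFrom false ds (Φ ∘ (false ∷_)) + ∑marksFrom true ds (Φ ∘ (true ∷_))))))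

-- A descent that follows a non-descent is a peak: its letter must differ from the preceding letter
-- q, and the other summand vanishes.
∑covers-flip : ∀ q ds Φ → ∑covers false q (true ∷ ds) Φ ≡ ∑covers true (not q) ds (Φ ∘ (not q ∷_))
∑covers-flip false ds Φ = trans (∑-listsOfLength-bools (length ds) _)
  (cong (_+ ∑covers true true ds (Φ ∘ (true ∷_))) (∑-0 (listsOfLength (length ds) bools)))
∑covers-flip true  ds Φ = trans (∑-listsOfLength-bools (length ds) _)
  (trans (cong (∑covers true false ds (Φ ∘ (false ∷_)) +_) (∑-0 (listsOfLength (length ds) bools))) (+-identityʳ _))

-- Because p = true, the first letter is no peak and q is never consulted. Keeping q arbitrary lets
-- each recursive call take for q the letter that has just been fixed.
∑marks≡∑covers : ∀ ds Φ q → ∑marks ds Φ ≡ 2 ^ suc (count (peakWord true ds)) * ∑covers true q ds Φ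
∑marks≡∑covers [] Φ q = trans (cong (_+ (Φ [] + 0)) (sym (+-identityʳ (Φ [])))) (sym (double (Φ [] + 0)))
-- An initial descent: the two values of its mark give the two values of the letter, so no factor
-- arises.
∑marks≡∑covers (true ∷ ds) Φ q = begin
  ∑marks (true ∷ ds) Φ
    ≡⟨ ∑marks-split (true ∷ ds) Φ ⟩
  ∑marksFrom false (true ∷ ds) Φ + ∑marksFrom true (true ∷ ds) Φ
    ≡⟨ cong₂ _+_ (trans (∑marksFrom-true false ds Φ) (∑marks≡∑covers ds (Φ ∘ (true ∷_)) true))
                 (trans (∑marksFrom-true true ds Φ) (∑marks≡∑covers ds (Φ ∘ (false ∷_)) false)) ⟩
  c * ∑covers true true ds (Φ ∘ (true ∷_)) + c * ∑covers true false ds (Φ ∘ (false ∷_))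
    ≡⟨ *-distribˡ-+ c _ _ ⟨
  c * (∑covers true true ds (Φ ∘ (true ∷_)) + ∑covers true false ds (Φ ∘ (false ∷_)))
    ≡⟨ cong (c *_) (trans (+-comm (∑covers true true ds _) _) (sym (∑-listsOfLength-bools (length ds) _))) ⟩
  c * ∑covers true q (true ∷ ds) Φ ∎
  where
  open ≡-Reasoning
  c : ℕ
  c = 2 ^ suc (count (peakWord true ds))
∑marks≡∑covers (false ∷ []) Φ q = trans (∑marks-false [] Φ)
  (cong (2 *_) (trans (cong₂ _+_ (+-identityʳ (Φ (false ∷ []))) (+-identityʳ (Φ (true ∷ []))))
                      (sym (cong (Φ (false ∷ []) +_) (+-identityʳ (Φ (true ∷ [])))))))
-- The free first mark gives a factor 2. It is spent on restoring the sum over the second mark,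
-- which the first letter has fixed but which influences nothing further at a second non-descent.
∑marks≡∑covers (false ∷ false ∷ ds) Φ q = begin
  ∑marks (false ∷ false ∷ ds) Φ
    ≡⟨ ∑marks-false (false ∷ ds) Φ ⟩
  2 * (∑marksFrom false (false ∷ ds) (Φ ∘ (false ∷_)) + ∑marksFrom true (false ∷ ds) (Φ ∘ (true ∷_)))
    ≡⟨ *-distribˡ-+ 2 (∑marksFrom false (false ∷ ds) (Φ ∘ (false ∷_))) _ ⟩
  2 * ∑marksFrom false (false ∷ ds) (Φ ∘ (false ∷_)) + 2 * ∑marksFrom true (false ∷ ds) (Φ ∘ (true ∷_))
    ≡⟨ cong₂ _+_ (trans (twice false (Φ ∘ (false ∷_))) (trans (∑marks≡∑covers (false ∷ ds) (Φ ∘ (false ∷_)) false) (restart false (Φ ∘ (false ∷_)))))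
                 (trans (twice true (Φ ∘ (true ∷_))) (trans (∑marks≡∑covers (false ∷ ds) (Φ ∘ (true ∷_)) true) (restart true (Φ ∘ (true ∷_))))) ⟩
  c * ∑covers false false (false ∷ ds) (Φ ∘ (false ∷_)) + c * ∑covers false true (false ∷ ds) (Φ ∘ (true ∷_))
    ≡⟨ *-distribˡ-+ c _ _ ⟨
  c * (∑covers false false (false ∷ ds) (Φ ∘ (false ∷_)) + ∑covers false true (false ∷ ds) (Φ ∘ (true ∷_)))
    ≡⟨ cong (c *_) (∑-listsOfLength-bools (suc (length ds)) _) ⟨
  c * ∑covers true q (false ∷ false ∷ ds) Φ ∎
  where
  open ≡-Reasoning
  c : ℕ
  c = 2 ^ suc (count (peakWord true (false ∷ ds)))
  twice : ∀ m Ψ → 2 * ∑marksFrom m (false ∷ ds) Ψ ≡ ∑marks (false ∷ ds) Ψ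
  twice m Ψ = trans (cong (2 *_) (∑marksFrom-false m ds Ψ)) (sym (∑marks-false ds Ψ))
  -- The next letter of `ds` is `false`, no peak whatever precedes it, so p may change from true to
  -- false.
  restart : ∀ m Ψ → c * ∑covers true m (false ∷ ds) Ψ ≡ c * ∑covers false m (false ∷ ds) Ψ
  restart m Ψ = cong (c *_) (trans (∑-listsOfLength-bools (length ds) _) (sym (∑-listsOfLength-bools (length ds) _)))
-- A peak at the second place: the second mark is the first letter of E, and its negation is the
-- second letter. The free first mark is the extra factor 2 that this peak contributes.
∑marks≡∑covers (false ∷ true ∷ ds) Φ q = begin
  ∑marks (false ∷ true ∷ ds) Φ
    ≡⟨ ∑marks-false (true ∷ ds) Φ ⟩
  2 * (∑marksFrom false (true ∷ ds) (Φ ∘ (false ∷_)) + ∑marksFrom true (true ∷ ds) (Φ ∘ (true ∷_)))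
    ≡⟨ cong (2 *_) (cong₂ _+_ (trans (∑marksFrom-true false ds (Φ ∘ (false ∷_))) (∑marks≡∑covers ds (Φ ∘ (false ∷_) ∘ (true ∷_)) true))
                              (trans (∑marksFrom-true true ds (Φ ∘ (true ∷_))) (∑marks≡∑covers ds (Φ ∘ (true ∷_) ∘ (false ∷_)) false))) ⟩
  2 * (c * ∑covers true true ds (Φ ∘ (false ∷_) ∘ (true ∷_)) + c * ∑covers true false ds (Φ ∘ (true ∷_) ∘ (false ∷_)))
    ≡⟨ cong (2 *_) (*-distribˡ-+ c _ _) ⟨
  2 * (c * (∑covers true true ds (Φ ∘ (false ∷_) ∘ (true ∷_)) + ∑covers true false ds (Φ ∘ (true ∷_) ∘ (false ∷_))))
    ≡⟨ *-assoc 2 c _ ⟨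
  2 * c * (∑covers true true ds (Φ ∘ (false ∷_) ∘ (true ∷_)) + ∑covers true false ds (Φ ∘ (true ∷_) ∘ (false ∷_)))
    ≡⟨ cong (2 * c *_) (cong₂ _+_ (∑covers-flip false ds (Φ ∘ (false ∷_))) (∑covers-flip true ds (Φ ∘ (true ∷_)))) ⟨
  2 * c * (∑covers false false (true ∷ ds) (Φ ∘ (false ∷_)) + ∑covers false true (true ∷ ds) (Φ ∘ (true ∷_)))
    ≡⟨ cong (2 * c *_) (∑-listsOfLength-bools (suc (length ds)) _) ⟨
  2 * c * ∑covers true q (false ∷ true ∷ ds) Φ ∎
  where
  open ≡-Reasoning
  c : ℕ
  c = 2 ^ suc (count (peakWord true ds))

-- Peaks and spikes of characteristic words

length-indices : ∀ j b → length (indices j b) ≡ count b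
length-indices j []          = refl
length-indices j (true  ∷ b) = cong suc (length-indices (suc j) b)
length-indices j (false ∷ b) = length-indices (suc j) b

length-peakWord : ∀ p ds → length (peakWord p ds) ≡ length ds
length-peakWord p []       = refl
length-peakWord p (d ∷ ds) = cong suc (length-peakWord d ds)

bit-peakWord-suc : ∀ p ds i → bit (peakWord p ds) (suc i) ≡ bit ds (suc i) ∧ not (bit ds i)
bit-peakWord-suc p []           i       = refl
bit-peakWord-suc p (d ∷ [])     i       = refl
bit-peakWord-suc p (d ∷ d′ ∷ ds) zero    = refl
bit-peakWord-suc p (d ∷ ds@(_ ∷ _)) (suc i) = bit-peakWord-suc d ds i

Peak-indices : ∀ ds → Peak (indices 1 ds) ≡ indices 1 (peakWord true ds)
Peak-indices ds = filterᵇ-indices _ 1 ds (peakWord true ds) (length-peakWord true ds) (eq ds)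
  where
  eq : ∀ ds i → bit (peakWord true ds) i ≡ bit ds i ∧ ((2 ≤ᵇ suc i) ∧ not (elemℕ i (indices 1 ds)))
  eq []      zero    = refl
  eq (_ ∷ _) zero    = refl
  eq ds      (suc i) = trans (bit-peakWord-suc true ds i)
    (cong (λ z → bit ds (suc i) ∧ not z) (sym (elemℕ-indices 1 i ds)))

-- Names the predicate of Spike, which is built from a function local to its definition.
spikePredicate : ∀ n E → ∃ λ q → Spike n E ≡ filterᵇ q (from1 n)
spikePredicate n E = _ , refl

spikePredicate-xor : ∀ n E x →
  proj₁ (spikePredicate n E) x ≡ (2 ≤ᵇ x) ∧ (elemℕ x E xor elemℕ (x ∸ 1) E)
spikePredicate-xor n E x with elemℕ x E | elemℕ (x ∸ 1) E
... | true  | true  = refl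
... | true  | false = refl
... | false | true  = refl
... | false | false = refl

elemℕ-Spike : ∀ n i es → suc i < n →
  elemℕ (2 + i) (Spike n (indices 1 es)) ≡ bit es (suc i) xor bit es i
elemℕ-Spike n i es i<n = begin
  elemℕ (2 + i) (Spike n E)
    ≡⟨ elemℕ-filterᵇ (2 + i) (proj₁ (spikePredicate n E)) (from1 n) ⟩
  elemℕ (2 + i) (from1 n) ∧ proj₁ (spikePredicate n E) (2 + i)
    ≡⟨ cong₂ _∧_ (elemℕ-from1 n (suc i) i<n) (spikePredicate-xor n E (2 + i)) ⟩
  elemℕ (2 + i) E xor elemℕ (1 + i) E
    ≡⟨ cong₂ _xor_ (elemℕ-indices 1 (suc i) es) (elemℕ-indices 1 i es) ⟩
  bit es (suc i) xor bit es i ∎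
  where
  open ≡-Reasoning
  E : List ℕ
  E = indices 1 es

-- Agreement is demanded at peaks only. At index 1, which is never a spike, the `xor` with the
-- artificial letter q may be true, and p = true keeps peaks away from there.
all-peakWord : ∀ f j p q ds es → length es ≡ length ds →
  (∀ i → T (bit (peakWord p ds) i) → f (j + i) ≡ bit es i xor bit (q ∷ es) i) →
  all f (indices j (peakWord p ds)) ≡ spikesCover p q ds es
all-peakWord f j p q []       []       len eq = refl
all-peakWord f j p q (d ∷ ds) (e ∷ es) len eq
  with d ∧ not p | eq 0 | all-peakWord f (suc j) d e ds es (suc-injective len)
                            (λ i t → trans (cong f (sym (+-suc j i))) (eq (suc i) t))
... | true  | eq0 | ih = cong₂ _∧_ (trans (cong f (sym (+-identityʳ j))) (eq0 tt)) ih
... | false | eq0 | ih = ih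

all-Spike : ∀ ds es → length es ≡ length ds →
  all (λ p → elemℕ p (Spike (suc (length ds)) (indices 1 es))) (indices 1 (peakWord true ds)) ≡
  spikesCover true true ds es
all-Spike ds es len = all-peakWord _ 1 true true ds es len (eq ds)
  where
  eq : ∀ ds i → T (bit (peakWord true ds) i) →
    elemℕ (suc i) (Spike (suc (length ds)) (indices 1 es)) ≡ bit es i xor bit (true ∷ es) i
  eq (true  ∷ _) zero    t = ⊥-elim t
  eq (false ∷ _) zero    t = ⊥-elim t
  eq ds          (suc i) t = elemℕ-Spike _ i es
    (m<n⇒m<1+n (subst (suc i <_) (length-peakWord true ds) (bit⇒< (peakWord true ds) (suc i) t)))

∑marks-indices : (F : List ℕ → ℕ) (ds : List Bool) →
  ∑ (listsOfLength (suc (length ds)) bools) (λ m → F (indices 1 (markedDescents m ds))) ≡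
  2 ^ (length (Peak (indices 1 ds)) + 1) *
  ∑ (filterᵇ (λ E → all (λ p → elemℕ p (Spike (suc (length ds)) E)) (Peak (indices 1 ds)))
             (sublists (from1 (length ds)))) F
∑marks-indices F ds rewrite Peak-indices ds = begin
  ∑marks ds (F ∘ indices 1)
    ≡⟨ ∑marks≡∑covers ds (F ∘ indices 1) true ⟩
  2 ^ suc (count (peakWord true ds)) * ∑covers true true ds (F ∘ indices 1)
    ≡⟨ cong₂ _*_ (cong (2 ^_) (trans (cong suc (sym (length-indices 1 (peakWord true ds)))) (+-comm 1 _)))
                 (trans (∑-cong (listsOfLength n bools) (λ {es} es∈ →
                          cong (λ b → if b then F (indices 1 es) else 0)
                            (sym (all-Spike ds es (proj₁ (∈-listsOfLength⁻ n bools es∈))))))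
                        (sym (trans (∑-filterᵇ _ (sublists (from1 n))) (∑-sublists-from1 n)))) ⟩
  2 ^ (length P + 1) * ∑ (filterᵇ (λ E → all (λ p → elemℕ p (Spike (suc n) E)) P) (sublists (from1 n))) F ∎
  where
  open ≡-Reasoning
  n : ℕ
  n = length ds
  P : List ℕ
  P = indices 1 (peakWord true ds)

-- Boolean reflection

T-∧⁻ : ∀ {a b} → T (a ∧ b) → T a × T b
T-∧⁻ = Equivalence.to T-∧

T⇒true : ∀ {b} → T b → b ≡ true
T⇒true = Equivalence.to T-≡

¬T⇒false : ∀ {b} → ¬ T b → b ≡ false
¬T⇒false {true}  ¬t = contradiction tt ¬t
¬T⇒false {false} ¬t = refl

<⇒<ᵇ-true : ∀ {m n} → m < n → (m <ᵇ n) ≡ true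
<⇒<ᵇ-true m<n = T⇒true (<⇒<ᵇ m<n)

≤⇒<ᵇ-false : ∀ {m n} → n ≤ m → (m <ᵇ n) ≡ false
≤⇒<ᵇ-false {m} {n} n≤m = ¬T⇒false (λ t → <⇒≱ (<ᵇ⇒< m n t) n≤m)

module _ {A : Set} where

  any⁻-∃ : ∀ p (xs : List A) → T (any p xs) → ∃ λ x → x ∈ xs × T (p x)
  any⁻-∃ p (x ∷ xs) t with p x in eq
  ... | true  = x , here refl , subst T (sym eq) tt
  ... | false with any⁻-∃ p xs t
  ... | y , y∈ , py = y , there y∈ , py

  any⁺-∈ : ∀ p {x} (xs : List A) → x ∈ xs → T (p x) → T (any p xs)
  any⁺-∈ p (x ∷ xs) (here refl) t = Equivalence.from T-∨ (inj₁ t)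
  any⁺-∈ p (y ∷ xs) (there x∈)  t = Equivalence.from (T-∨ {p y}) (inj₂ (any⁺-∈ p xs x∈ t))

  all⁻-∈ : ∀ p {x} (xs : List A) → T (all p xs) → x ∈ xs → T (p x)
  all⁻-∈ p (x ∷ xs) t (here refl) = proj₁ (T-∧⁻ t)
  all⁻-∈ p (y ∷ xs) t (there x∈)  = all⁻-∈ p xs (proj₂ (T-∧⁻ {p y} t)) x∈

  ∈-filterᵇ⁻ : ∀ p {x} (xs : List A) → x ∈ filterᵇ p xs → x ∈ xs × T (p x)
  ∈-filterᵇ⁻ p xs x∈ = ∈-filter⁻ (T? ∘ p) {xs = xs} x∈

  ∈-filterᵇ⁺ : ∀ p {x} {xs : List A} → x ∈ xs → T (p x) → x ∈ filterᵇ p xs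
  ∈-filterᵇ⁺ p x∈ t = ∈-filter⁺ (T? ∘ p) x∈ t

  ∈-sublists⁻ : (xs : List A) {ys : List A} → ys ∈ sublists xs → ∀ {y} → y ∈ ys → y ∈ xs
  ∈-sublists⁻ []       (here refl) ()
  ∈-sublists⁻ (x ∷ xs) ys∈ y∈ with ∈-++⁻ (sublists xs) ys∈
  ... | inj₁ ys∈l = there (∈-sublists⁻ xs ys∈l y∈)
  ... | inj₂ ys∈r with ∈-map⁻ (x ∷_) ys∈r
  ∈-sublists⁻ (x ∷ xs) ys∈ (here refl) | inj₂ _ | _ , _   , refl = here refl
  ∈-sublists⁻ (x ∷ xs) ys∈ (there y∈)  | inj₂ _ | _ , zs∈ , refl = there (∈-sublists⁻ xs zs∈ y∈)

  Unique⊆⇒length≤ : {xs ys : List A} → Unique xs → (∀ {x} → x ∈ xs → x ∈ ys) → length xs ≤ length ys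
  Unique⊆⇒length≤ []        sub = z≤n
  Unique⊆⇒length≤ {xs = x ∷ xs} (x∉ ∷ u) sub with ∈-∃++ (sub (here refl))
  ... | as , bs , refl = subst (suc (length xs) ≤_) (sym (length-remove as bs)) (s≤s (Unique⊆⇒length≤ u sub′))
    where
    length-remove : ∀ as bs → length (as ++ x ∷ bs) ≡ suc (length (as ++ bs))
    length-remove []       bs = refl
    length-remove (_ ∷ as) bs = cong suc (length-remove as bs)
    sub′ : ∀ {y} → y ∈ xs → y ∈ as ++ bs
    sub′ y∈ with ∈-++⁻ as (sub (there y∈))
    ... | inj₁ y∈as         = ∈-++⁺ˡ y∈as
    ... | inj₂ (here refl)  = contradiction refl (All.lookup x∉ y∈)
    ... | inj₂ (there y∈bs) = ∈-++⁺ʳ as y∈bs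

elemℕ⁺ : ∀ {x} xs → x ∈ xs → T (elemℕ x xs)
elemℕ⁺ {x} xs x∈ = any⁺-∈ (x ≡ᵇ_) xs x∈ (≡⇒≡ᵇ x x refl)

allDistinct⇒Unique : ∀ xs → T (allDistinct xs) → Unique xs
allDistinct⇒Unique []       _ = []
allDistinct⇒Unique (x ∷ xs) t with T-∧⁻ {not (elemℕ x xs)} t
... | x∉ , u = All.tabulate (λ {y} y∈ x≡y → subst T (cong not (T⇒true (elemℕ⁺ xs (subst (_∈ xs) (sym x≡y) y∈)))) x∉)
               ∷ allDistinct⇒Unique xs u

∈-range⁻ : ∀ j n {x} → x ∈ range j n → j ≤ x × x < j + n
∈-range⁻ j (suc n) (here refl) = ≤-refl , m<m+n j (s≤s z≤n)
∈-range⁻ j (suc n) {x} (there x∈) with ∈-range⁻ (suc j) n x∈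
... | j<x , x<  = <⇒≤ j<x , subst (_<_ x) (sym (+-suc j n)) x<

∈-range⁺ : ∀ j n {x} → j ≤ x → x < j + n → x ∈ range j n
∈-range⁺ j zero    j≤x x< = contradiction (subst (_ <_) (+-identityʳ j) x<) (≤⇒≯ j≤x)
∈-range⁺ j (suc n) {x} j≤x x< with j ≟ x
... | yes refl = here refl
... | no  j≢x  = there (∈-range⁺ (suc j) n (≤∧≢⇒< j≤x j≢x) (subst (x <_) (+-suc j n) x<))

range-Unique : ∀ j n → Unique (range j n)
range-Unique j zero    = []
range-Unique j (suc n) = All.tabulate (λ x∈ → <⇒≢ (proj₁ (∈-range⁻ (suc j) n x∈))) ∷ range-Unique (suc j) n

length-range : ∀ j n → length (range j n) ≡ n
length-range j zero    = refl
length-range j (suc n) = cong suc (length-range (suc j) n)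

-- Lists of cells as finite sets

cellEq⇒≡ : ∀ x y → T (cellEq x y) → x ≡ y
cellEq⇒≡ (a , b) (c , d) t with T-∧⁻ {a ≡ᵇ c} t
... | p , q = cong₂ _,_ (≡ᵇ⇒≡ a c p) (≡ᵇ⇒≡ b d q)

cellEq-refl : ∀ x → T (cellEq x x)
cellEq-refl (a , b) = Equivalence.from T-∧ (≡⇒≡ᵇ a a refl , ≡⇒≡ᵇ b b refl)

elemC⁻ : ∀ x xs → T (elemC x xs) → x ∈ xs
elemC⁻ x xs t with any⁻-∃ (cellEq x) xs t
... | y , y∈ , eq = subst (_∈ xs) (sym (cellEq⇒≡ x y eq)) y∈

elemC⁺ : ∀ {x xs} → x ∈ xs → T (elemC x xs)
elemC⁺ {x} {xs} x∈ = any⁺-∈ (cellEq x) xs x∈ (cellEq-refl x)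

∈-minusC⁻ : ∀ xs ys {x} → x ∈ minusC xs ys → x ∈ xs × x ∉ ys
∈-minusC⁻ xs ys {x} x∈ with ∈-filterᵇ⁻ (λ x → not (elemC x ys)) xs x∈
... | x∈xs , t = x∈xs , λ x∈ys → subst T (cong not (T⇒true (elemC⁺ x∈ys))) t

∈-minusC⁺ : ∀ xs ys {x} → x ∈ xs → x ∉ ys → x ∈ minusC xs ys
∈-minusC⁺ xs ys {x} x∈ x∉ =
  ∈-filterᵇ⁺ _ x∈ (Equivalence.from T-not-≡ (¬T⇒false (x∉ ∘ elemC⁻ x ys)))

subsetC⁻ : ∀ xs ys → T (subsetC xs ys) → ∀ {x} → x ∈ xs → x ∈ ys
subsetC⁻ xs ys t x∈ = elemC⁻ _ ys (all⁻-∈ _ xs t x∈)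

-- Shifted diagrams

strict-tail : ∀ l ls → T (isStrictPartition (l ∷ ls)) → T (isStrictPartition ls)
strict-tail l []       _ = tt
strict-tail l (x ∷ ls) t = proj₂ (T-∧⁻ {x <ᵇ l} t)

strict-pos : ∀ {l} ls → T (isStrictPartition (l ∷ ls)) → 0 < l
strict-pos {l} []       t = <ᵇ⇒< 0 l t
strict-pos {l} (x ∷ ls) t = ≤-<-trans z≤n (<ᵇ⇒< x l (proj₁ (T-∧⁻ {x <ᵇ l} t)))

∈-cellsFrom⁻ : ∀ r₀ l ls {c r} → (c , r) ∈ cellsFrom r₀ (l ∷ ls) →
  (r ≡ r₀ × r₀ ≤ c × c < r₀ + l) ⊎ (c , r) ∈ cellsFrom (suc r₀) ls
∈-cellsFrom⁻ r₀ l ls x∈ with ∈-++⁻ (applyUpTo (λ j → (r₀ + j , r₀)) l) x∈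
... | inj₂ x∈ls = inj₂ x∈ls
... | inj₁ x∈l with ∈-applyUpTo⁻ (λ j → (r₀ + j , r₀)) x∈l
... | j , j<l , refl = inj₁ (refl , m≤m+n r₀ j , +-monoʳ-< r₀ j<l)

∈-cellsFrom-row : ∀ r₀ l ls {c} → r₀ ≤ c → c < r₀ + l → (c , r₀) ∈ cellsFrom r₀ (l ∷ ls)
∈-cellsFrom-row r₀ l ls {c} r₀≤c c< =
  ∈-++⁺ˡ (subst (λ z → (z , r₀) ∈ row₀) (m+[n∸m]≡n r₀≤c) (∈-applyUpTo⁺ (λ j → (r₀ + j , r₀)) c∸r₀<l))
  where
  row₀ : List Cell
  row₀ = applyUpTo (λ j → (r₀ + j , r₀)) l
  c∸r₀<l : c ∸ r₀ < l
  c∸r₀<l = +-cancelˡ-< r₀ _ _ (subst (_< r₀ + l) (sym (m+[n∸m]≡n r₀≤c)) c<)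

∈-cellsFrom-there : ∀ r₀ l ls {x} → x ∈ cellsFrom (suc r₀) ls → x ∈ cellsFrom r₀ (l ∷ ls)
∈-cellsFrom-there r₀ l ls x∈ = ∈-++⁺ʳ (applyUpTo (λ j → (r₀ + j , r₀)) l) x∈

cellsFrom-bounds : ∀ r₀ ls {c r} → (c , r) ∈ cellsFrom r₀ ls → r₀ ≤ r × r ≤ c
cellsFrom-bounds r₀ (l ∷ ls) x∈ with ∈-cellsFrom⁻ r₀ l ls x∈
... | inj₁ (refl , r₀≤c , _) = ≤-refl , r₀≤c
... | inj₂ x∈ls with cellsFrom-bounds (suc r₀) ls x∈ls
... | r₀<r , r≤c = <⇒≤ r₀<r , r≤c

-- The strict decrease of the parts compensates the shift of each higher row by one, so no row
-- reaches further right than the lowest.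
cellsFrom-col< : ∀ r₀ l ls → T (isStrictPartition (l ∷ ls)) → ∀ {c r} → (c , r) ∈ cellsFrom r₀ (l ∷ ls) → c < r₀ + l
cellsFrom-col< r₀ l ls st x∈ with ∈-cellsFrom⁻ r₀ l ls x∈
... | inj₁ (_ , _ , c<) = c<
cellsFrom-col< r₀ l (l′ ∷ ls) st x∈ | inj₂ x∈ls =
  <-≤-trans (cellsFrom-col< (suc r₀) l′ ls (strict-tail l (l′ ∷ ls) st) x∈ls)
            (subst (_≤ r₀ + l) (+-suc r₀ l′) (+-monoʳ-≤ r₀ (<ᵇ⇒< l′ l (proj₁ (T-∧⁻ {l′ <ᵇ l} st)))))

cellsFrom-closed : ∀ r₀ ls → T (isStrictPartition ls) → ∀ {c r c′ r′} → (c , r) ∈ cellsFrom r₀ ls →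
  r₀ ≤ r′ → r′ ≤ r → r′ ≤ c′ → c′ ≤ c → (c′ , r′) ∈ cellsFrom r₀ ls
cellsFrom-closed r₀ (l ∷ ls) st {r′ = r′} x∈ r₀≤r′ r′≤r r′≤c′ c′≤c with r₀ ≟ r′
... | yes refl = ∈-cellsFrom-row r₀ l ls r′≤c′ (≤-<-trans c′≤c (cellsFrom-col< r₀ l ls st x∈))
... | no r₀≢r′ with ∈-cellsFrom⁻ r₀ l ls x∈
... | inj₁ (refl , _) = contradiction (≤-antisym r₀≤r′ r′≤r) r₀≢r′
... | inj₂ x∈ls = ∈-cellsFrom-there r₀ l ls
  (cellsFrom-closed (suc r₀) ls (strict-tail l ls st) x∈ls (≤∧≢⇒< r₀≤r′ r₀≢r′) r′≤r r′≤c′ c′≤c)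

-- Needed because a tableau is only required to end at a partition with the same cells as λ. The two
-- inclusions bound the lowest rows by each other, and the rows above them are compared by
-- induction.
cellsFrom-injective : ∀ r₀ p q → T (isStrictPartition p) → T (isStrictPartition q) →
  (∀ {x} → x ∈ cellsFrom r₀ p → x ∈ cellsFrom r₀ q) → (∀ {x} → x ∈ cellsFrom r₀ q → x ∈ cellsFrom r₀ p) → p ≡ q
cellsFrom-injective r₀ []      []      sp sq p⊆q q⊆p = refl
cellsFrom-injective r₀ []      (y ∷ q) sp sq p⊆q q⊆p
  with () ← q⊆p (∈-cellsFrom-row r₀ y q {r₀} ≤-refl (m<m+n r₀ (strict-pos q sq)))
cellsFrom-injective r₀ (x ∷ p) []      sp sq p⊆q q⊆p
  with () ← p⊆q (∈-cellsFrom-row r₀ x p {r₀} ≤-refl (m<m+n r₀ (strict-pos p sp)))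
cellsFrom-injective r₀ (x ∷ p) (y ∷ q) sp sq p⊆q q⊆p =
  cong₂ _∷_ (≤-antisym (row≤ x y p q sp sq p⊆q) (row≤ y x q p sq sp q⊆p))
            (cellsFrom-injective (suc r₀) p q (strict-tail x p sp) (strict-tail y q sq) (above x y p q p⊆q) (above y x q p q⊆p))
  where
  row≤ : ∀ x y p q → T (isStrictPartition (x ∷ p)) → T (isStrictPartition (y ∷ q)) →
    (∀ {z} → z ∈ cellsFrom r₀ (x ∷ p) → z ∈ cellsFrom r₀ (y ∷ q)) → x ≤ y
  row≤ zero    y p q sp sq sub = z≤n
  row≤ (suc x) y p q sp sq sub = +-cancelˡ-< r₀ x y
    (cellsFrom-col< r₀ y q sq (sub (∈-cellsFrom-row r₀ (suc x) p (m≤m+n r₀ x) (+-monoʳ-< r₀ ≤-refl))))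
  above : ∀ x y p q → (∀ {z} → z ∈ cellsFrom r₀ (x ∷ p) → z ∈ cellsFrom r₀ (y ∷ q)) →
    ∀ {z} → z ∈ cellsFrom (suc r₀) p → z ∈ cellsFrom (suc r₀) q
  above x y p q sub z∈ with ∈-cellsFrom⁻ r₀ y q (sub (∈-cellsFrom-there r₀ x p z∈))
  ... | inj₂ z∈q = z∈q
  ... | inj₁ (refl , _) = contradiction (proj₁ (cellsFrom-bounds (suc r₀) p z∈)) (<⇒≱ ≤-refl)

∈-strictUpTo⇒strict : ∀ N {p} → p ∈ strictUpTo N → T (isStrictPartition p) × firstPart p ≤ N
∈-strictUpTo⇒strict zero    (here refl) = tt , z≤n
∈-strictUpTo⇒strict (suc N) p∈ with ∈-++⁻ (strictUpTo N) p∈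
... | inj₁ p∈N with ∈-strictUpTo⇒strict N p∈N
... | st , ≤N = st , m≤n⇒m≤1+n ≤N
∈-strictUpTo⇒strict (suc N) p∈ | inj₂ p∈m with ∈-map⁻ (suc N ∷_) p∈m
... | q , q∈ , refl with ∈-strictUpTo⇒strict N q∈
∈-strictUpTo⇒strict (suc N) p∈ | inj₂ p∈m | []    , q∈ , refl | st , ≤N = tt , ≤-refl
∈-strictUpTo⇒strict (suc N) p∈ | inj₂ p∈m | y ∷ q , q∈ , refl | st , ≤N =
  Equivalence.from T-∧ (<⇒<ᵇ (s≤s ≤N) , st) , ≤-refl

∈-subparts⇒strict : ∀ la {p} → p ∈ subparts la → T (isStrictPartition p)
∈-subparts⇒strict la p∈ =
  proj₁ (∈-strictUpTo⇒strict (firstPart la) (proj₁ (∈-filterᵇ⁻ (λ mu → subsetC (cells mu) (cells la)) _ p∈)))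

-- Ribbon heads

-- For a double ribbon X is the whole union R ∪ S. Maximality over X is what makes the heads of
-- consecutive additions comparable.
IsHead : List Cell → Cell → Set
IsHead X h = h ∈ X × (∀ {x} → x ∈ X → diagVal x ≤ diagVal h)

headC-isHead : ∀ x xs → IsHead (x ∷ xs) (headC (x ∷ xs))
headC-isHead x [] = here refl , λ { (here refl) → ≤-refl }
headC-isHead x (y ∷ xs) with headC-isHead x xs
... | m∈ , max with diagVal (headC (x ∷ xs)) <ᵇ diagVal y in lt
... | true  = there (here refl) , λ
  { (here refl)         → <⇒≤ (≤-<-trans (max (here refl)) m<y)
  ; (there (here refl)) → ≤-refl
  ; (there (there z∈))  → <⇒≤ (≤-<-trans (max (there z∈)) m<y) }
  where
  m<y : diagVal (headC (x ∷ xs)) < diagVal y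
  m<y = <ᵇ⇒< _ _ (subst T (sym lt) tt)
... | false = weaken m∈ , λ
  { (here refl)         → max (here refl)
  ; (there (here refl)) → ≮⇒≥ (λ m<y → subst T lt (<⇒<ᵇ m<y))
  ; (there (there z∈))  → max (there z∈) }
  where
  weaken : ∀ {z} → z ∈ x ∷ xs → z ∈ x ∷ y ∷ xs
  weaken (here refl) = here refl
  weaken (there z∈)  = there (there z∈)

tailC-∈ : ∀ x xs → tailC (x ∷ xs) ∈ x ∷ xs
tailC-∈ x [] = here refl
tailC-∈ x (y ∷ xs) with diagVal y <ᵇ diagVal (tailC (x ∷ xs)) | tailC-∈ x xs
... | true  | _         = there (here refl)
... | false | here eq   = here eq
... | false | there t∈  = there (there t∈)

suc-∸-≤ : ∀ a b → suc a ∸ b ≤ suc (a ∸ b)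
suc-∸-≤ a       zero    = ≤-refl
suc-∸-≤ zero    (suc b) = subst (_≤ 1) (sym (0∸n≡0 b)) z≤n
suc-∸-≤ (suc a) (suc b) = suc-∸-≤ a b

∸-suc-≤ : ∀ a b → a ∸ b ≤ suc (a ∸ suc b)
∸-suc-≤ zero    b       = subst (_≤ 1) (sym (0∸n≡0 b)) z≤n
∸-suc-≤ (suc a) zero    = ≤-refl
∸-suc-≤ (suc a) (suc b) = ∸-suc-≤ a b

adjacent-diagVal : ∀ x y → T (adjacent x y) →
  diagVal x ≤ suc (diagVal y) × diagVal y ≤ suc (diagVal x)
adjacent-diagVal (a , b) (c , d) t with Equivalence.to (T-∨ {(b ≡ᵇ d) ∧ _}) t
... | inj₁ u with T-∧⁻ {b ≡ᵇ d} u
... | bd , v rewrite sym (≡ᵇ⇒≡ b d bd) with Equivalence.to (T-∨ {suc a ≡ᵇ c}) v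
... | inj₁ w rewrite sym (≡ᵇ⇒≡ (suc a) c w) = s≤s (m≤n⇒m≤1+n (∸-monoˡ-≤ b (n≤1+n a))) , s≤s (suc-∸-≤ a b)
... | inj₂ w rewrite sym (≡ᵇ⇒≡ (suc c) a w) = s≤s (suc-∸-≤ c b) , s≤s (m≤n⇒m≤1+n (∸-monoˡ-≤ b (n≤1+n c)))
adjacent-diagVal (a , b) (c , d) t | inj₂ u with T-∧⁻ {a ≡ᵇ c} u
... | ac , v rewrite sym (≡ᵇ⇒≡ a c ac) with Equivalence.to (T-∨ {suc b ≡ᵇ d}) v
... | inj₁ w rewrite sym (≡ᵇ⇒≡ (suc b) d w) = s≤s (∸-suc-≤ a b) , s≤s (m≤n⇒m≤1+n (∸-monoʳ-≤ a (n≤1+n b)))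
... | inj₂ w rewrite sym (≡ᵇ⇒≡ (suc d) b w) = s≤s (m≤n⇒m≤1+n (∸-monoʳ-≤ a (n≤1+n d))) , s≤s (∸-suc-≤ a d)

Between : ℕ → ℕ → ℕ → Set
Between a b v = (a ≤ v × v ≤ b) ⊎ (b ≤ v × v ≤ a)

-- Diagonal values change by at most 1 along an edge, so a connected set attains every
-- diagonal value between two of its own.
iterGrow-diagVals : ∀ n X S d → (∀ {y} → y ∈ S → ∀ {v} → Between d (diagVal y) v → v ∈ map diagVal X) →
  ∀ {y} → y ∈ iterGrow n X S → ∀ {v} → Between d (diagVal y) v → v ∈ map diagVal X
iterGrow-diagVals zero    X S d cov y∈ = cov y∈
iterGrow-diagVals (suc n) X S d cov y∈ = iterGrow-diagVals n X (growIn X S) d cov′ y∈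
  where
  cov′ : ∀ {y} → y ∈ growIn X S → ∀ {v} → Between d (diagVal y) v → v ∈ map diagVal X
  cov′ {y} y∈ {v} btw with ∈-filterᵇ⁻ (λ x → elemC x S ∨ any (adjacent x) S) X y∈
  ... | y∈X , t with Equivalence.to (T-∨ {elemC y S}) t
  ... | inj₁ y∈S = cov (elemC⁻ y S y∈S) btw
  ... | inj₂ adj with any⁻-∃ (adjacent y) S adj | v ≟ diagVal y
  ... | z , z∈S , yz | yes refl = ∈-map⁺ diagVal y∈X
  ... | z , z∈S , yz | no v≢ with adjacent-diagVal y z yz | btw
  ... | y≤ , z≤ | inj₁ (d≤v , v≤y) = cov z∈S (inj₁ (d≤v , ≤-pred (≤-trans (≤∧≢⇒< v≤y v≢) y≤)))
  ... | y≤ , z≤ | inj₂ (y≤v , v≤d) = cov z∈S (inj₂ (≤-trans z≤ (≤∧≢⇒< y≤v (v≢ ∘ sym)) , v≤d))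

-- All of the values 1, ..., `diagVal y` are attained, so X has at least that many cells.
edgeConnected⇒diagVal≤length : ∀ X → T (edgeConnected X) → ∀ {t} → t ∈ X → diagVal t ≡ 1 →
  ∀ {y} → y ∈ X → diagVal y ≤ length X
edgeConnected⇒diagVal≤length X@(x ∷ xs) conn {t} t∈ t≡1 {y} y∈ =
  subst₂ _≤_ (length-range 1 (diagVal y)) (length-map diagVal X)
    (Unique⊆⇒length≤ (range-Unique 1 (diagVal y)) attained)
  where
  cov : ∀ {y} → y ∈ X → ∀ {v} → Between (diagVal x) (diagVal y) v → v ∈ map diagVal X
  cov y∈ = iterGrow-diagVals (length X) X (x ∷ []) (diagVal x)
    (λ { (here refl) (inj₁ (p , q)) → subst (_∈ map diagVal X) (≤-antisym p q) (here refl)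
       ; (here refl) (inj₂ (p , q)) → subst (_∈ map diagVal X) (≤-antisym p q) (here refl) })
    (subsetC⁻ X _ conn y∈)
  attained : ∀ {v} → v ∈ range 1 (diagVal y) → v ∈ map diagVal X
  attained {v} v∈ with ∈-range⁻ 1 (diagVal y) v∈ | ≤-total v (diagVal x)
  -- Growth starts at x, so a value up to that of x is met on the way to t, and a value from there
  -- on is met on the way to y.
  ... | 1≤v , s≤s v≤y | inj₁ v≤x = cov t∈ (inj₂ (subst (_≤ v) (sym t≡1) 1≤v , v≤x))
  ... | 1≤v , s≤s v≤y | inj₂ x≤v = cov y∈ (inj₁ (x≤v , v≤y))

-- The opposite pigeonhole: the cells have distinct values among 1, ..., `diagVal h`.
length≤diagVal-head : ∀ R → T (allDistinct (map diagVal R)) → ∀ {h} → IsHead R h → length R ≤ diagVal h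
length≤diagVal-head R dist {h} (_ , max) =
  subst₂ _≤_ (length-map diagVal R) (length-range 1 (diagVal h))
    (Unique⊆⇒length≤ (allDistinct⇒Unique _ dist) sub)
  where
  sub : ∀ {v} → v ∈ map diagVal R → v ∈ range 1 (diagVal h)
  sub v∈ with ∈-map⁻ diagVal v∈
  ... | x , x∈ , refl = ∈-range⁺ 1 (diagVal h) (s≤s z≤n) (s≤s (max x∈))

nonempty-isHead : ∀ R → T (edgeConnected R) → IsHead R (headC R)
nonempty-isHead (x ∷ xs) _ = headC-isHead x xs

edgeConnected-tailC-∈ : ∀ S → T (edgeConnected S) → tailC S ∈ S
edgeConnected-tailC-∈ (x ∷ xs) _ = tailC-∈ x xs

-- R and S both start on diagonal 1, so R, being the longer one, reaches the larger diagonal value.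
doubleDecomp-isHead : ∀ L X R → (∀ {x} → x ∈ R → x ∈ X) →
  T (isDoubleDecomp L X R (minusC X R)) → IsHead X (headC R)
doubleDecomp-isHead L X R R⊆X t
  with T-∧⁻ {isSingleRibbon R} t
... | singleR , t with T-∧⁻ {isSingleRibbon (minusC X R)} t
... | singleS , t with T-∧⁻ {length (minusC X R) ≤ᵇ length R} t
... | S≤R , t with T-∧⁻ {elemC (tailC R) L} t
... | _ , t with T-∧⁻ {diagVal (tailC R) ≡ᵇ 1} t
... | _ , t with T-∧⁻ {elemC (tailC (minusC X R)) (minusC L R)} t
... | _ , t with T-∧⁻ {diagVal (tailC (minusC X R)) ≡ᵇ 1} t
... | tailS , _ = R⊆X (proj₁ headR) , max
  where
  S : List Cell
  S = minusC X R
  connR : T (edgeConnected R)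
  connR = proj₁ (T-∧⁻ {edgeConnected R} singleR)
  connS : T (edgeConnected S)
  connS = proj₁ (T-∧⁻ {edgeConnected S} singleS)
  headR : IsHead R (headC R)
  headR = nonempty-isHead R connR
  distR : T (allDistinct (map diagVal R))
  distR = proj₂ (T-∧⁻ {isSkewShifted R} (proj₂ (T-∧⁻ {edgeConnected R} singleR)))
  max : ∀ {x} → x ∈ X → diagVal x ≤ diagVal (headC R)
  max {x} x∈ with T? (elemC x R)
  ... | yes x∈R = proj₂ headR (elemC⁻ x R x∈R)
  ... | no  x∉R = begin
    diagVal x         ≤⟨ edgeConnected⇒diagVal≤length S connS (edgeConnected-tailC-∈ S connS)
                           (≡ᵇ⇒≡ (diagVal (tailC S)) 1 tailS) (∈-minusC⁺ X R x∈ (x∉R ∘ elemC⁺)) ⟩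
    length S          ≤⟨ ≤ᵇ⇒≤ (length S) (length R) S≤R ⟩
    length R          ≤⟨ length≤diagVal-head R distR headR ⟩
    diagVal (headC R) ∎
    where open ≤-Reasoning

doubleHeads-isHead : ∀ L X {h} → h ∈ doubleHeads L X → IsHead X h
doubleHeads-isHead L X h∈ with ∈-map⁻ headC h∈
... | R , R∈ , refl with ∈-filterᵇ⁻ (λ R → isDoubleDecomp L X R (minusC X R)) (sublists X) R∈
... | R∈X , dec = doubleDecomp-isHead L X R (∈-sublists⁻ X R∈X) dec

ribbonHead-isHead : ∀ k L X {h} → ribbonHead k L X ≡ just h → IsHead X h
ribbonHead-isHead k L X eq
  with length X ≡ᵇ k | isSingleRibbon X in single | doubleHeads L X in double
ribbonHead-isHead k L X refl | true | true | _ =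
  nonempty-isHead X (proj₁ (T-∧⁻ {edgeConnected X} (subst T (sym single) tt)))
ribbonHead-isHead k L X refl | true | false | h ∷ _ =
  doubleHeads-isHead L X (subst (h ∈_) (sym double) (here refl))

stepHead-isHead : ∀ k p q {h} → stepHead k p q ≡ just h → IsHead (minusC (cells q) (cells p)) h
stepHead-isHead k p q eq with subsetC (cells p) (cells q)
... | true = ribbonHead-isHead k (cells q) (minusC (cells q) (cells p)) eq

-- Of "strictly above" and "strictly to the right" exactly one holds for h′, and the reading order
-- tells which. Thus the vertical and the horizontal strip condition become the same Boolean and its
-- negation. The last equation makes the two heads comparable in the reading order.
Consecutive : Cell → Cell → Set
Consecutive h h′ =
  (row h <ᵇ row h′) ≡ readsBefore h′ h ×
  (col h <ᵇ col h′) ≡ not (readsBefore h′ h) ×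
  readsBefore h h′ ≡ not (readsBefore h′ h)

incomparable⇒Consecutive : ∀ h h′ → ¬ (col h′ ≤ col h × row h′ ≤ row h) →
  ¬ (col h < col h′ × row h < row h′) → Consecutive h h′
incomparable⇒Consecutive (a , b) (a′ , b′) ¬≤ ¬< with b <? b′
... | yes b<b′
  rewrite <⇒<ᵇ-true b<b′ | ≤⇒<ᵇ-false (<⇒≤ b<b′) | <⇒≡ᵇ-false b<b′
        | ≤⇒<ᵇ-false {a} {a′} (≮⇒≥ (λ a<a′ → ¬< (a<a′ , b<b′))) =
  refl , refl , refl
... | no b≮b′
  rewrite ≤⇒<ᵇ-false (≮⇒≥ b≮b′) | <⇒<ᵇ-true {a} {a′} (≰⇒> (λ a′≤a → ¬≤ (a′≤a , ≮⇒≥ b≮b′)))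
        | ≤⇒<ᵇ-false {a′} {a} (<⇒≤ (≰⇒> (λ a′≤a → ¬≤ (a′≤a , ≮⇒≥ b≮b′))))
  with m≤n⇒m<n∨m≡n (≮⇒≥ b≮b′)
... | inj₁ b′<b rewrite <⇒<ᵇ-true b′<b | <⇒≡ᵇ-false b′<b =
  refl , refl , refl
... | inj₂ refl rewrite ≤⇒<ᵇ-false {b} ≤-refl | ≡ᵇ-refl b =
  refl , refl , refl

-- If h′ lay strictly above and right of h = (a , b), then the cell (a′ , b) below h′ = (a′ , b′)
-- would be on a larger diagonal than h′ and than h, and it would belong to one of the two ribbons.
consecutiveHeads : ∀ k p q r {h h′} → T (isStrictPartition p) → T (isStrictPartition q) → T (isStrictPartition r) →
  stepHead k p q ≡ just h → stepHead k q r ≡ just h′ → Consecutive h h′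
consecutiveHeads k p q r {a , b} {a′ , b′} sp sq sr eq eq′
  with stepHead-isHead k p q eq | stepHead-isHead k q r eq′
... | h∈ , max | h′∈ , max′
  with ∈-minusC⁻ (cells q) (cells p) h∈ | ∈-minusC⁻ (cells r) (cells q) h′∈
... | h∈q , h∉p | h′∈r , h′∉q
  with cellsFrom-bounds 1 q h∈q | cellsFrom-bounds 1 r h′∈r
... | 1≤b , b≤a | 1≤b′ , b′≤a′ = incomparable⇒Consecutive (a , b) (a′ , b′) ¬≤ ¬<
  where
  ¬≤ : ¬ (a′ ≤ a × b′ ≤ b)
  ¬≤ (a′≤a , b′≤b) = h′∉q (cellsFrom-closed 1 q sq h∈q 1≤b′ b′≤b b′≤a′ a′≤a)
  ¬< : ¬ (a < a′ × b < b′)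
  ¬< (a<a′ , b<b′) = <⇒≱ diag< (≤-pred (max′ (∈-minusC⁺ (cells r) (cells q) x∈r x∉q)))
    where
    b≤a′ : b ≤ a′
    b≤a′ = ≤-trans b≤a (<⇒≤ a<a′)
    x∈r : (a′ , b) ∈ cells r
    x∈r = cellsFrom-closed 1 r sr h′∈r 1≤b (<⇒≤ b<b′) b≤a′ ≤-refl
    x∉q : (a′ , b) ∉ cells q
    x∉q x∈q = <⇒≱ (∸-monoˡ-< a<a′ b≤a) (≤-pred (max (∈-minusC⁺ (cells q) (cells p) x∈q
      (λ x∈p → h∉p (cellsFrom-closed 1 p sp x∈p 1≤b ≤-refl b≤a (<⇒≤ a<a′))))))
    diag< : a′ ∸ b′ < a′ ∸ b
    diag< = ∸-monoʳ-< b<b′ b′≤a′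

-- Sorted words and their descents

-- Only the absence of inversions is recorded, since comparability is established just for labels i
-- and i + 1.
Sorted : (ℕ → ℕ → Bool) → List ℕ → Set
Sorted lt = AllPairs (λ x y → lt y x ≡ false)

∈-insertBy⁺ : ∀ lt x {y} ys → y ∈ x ∷ ys → y ∈ insertBy lt x ys
∈-insertBy⁺ lt x []       y∈ = y∈
∈-insertBy⁺ lt x (z ∷ zs) y∈ with lt x z
∈-insertBy⁺ lt x (z ∷ zs) y∈                  | true  = y∈
∈-insertBy⁺ lt x (z ∷ zs) (here refl)         | false = there (∈-insertBy⁺ lt x zs (here refl))
∈-insertBy⁺ lt x (z ∷ zs) (there (here refl)) | false = here refl
∈-insertBy⁺ lt x (z ∷ zs) (there (there y∈))  | false = there (∈-insertBy⁺ lt x zs (there y∈))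

∈-insertBy⁻ : ∀ lt x {y} ys → y ∈ insertBy lt x ys → y ∈ x ∷ ys
∈-insertBy⁻ lt x []       y∈ = y∈
∈-insertBy⁻ lt x (z ∷ zs) y∈ with lt x z
∈-insertBy⁻ lt x (z ∷ zs) y∈          | true  = y∈
∈-insertBy⁻ lt x (z ∷ zs) (here refl) | false = there (here refl)
∈-insertBy⁻ lt x (z ∷ zs) (there y∈)  | false with ∈-insertBy⁻ lt x zs y∈
... | here refl = here refl
... | there y∈′ = there (there y∈′)

∈-sortBy⁺ : ∀ lt {y} ys → y ∈ ys → y ∈ sortBy lt ys
∈-sortBy⁺ lt (x ∷ ys) (here refl) = ∈-insertBy⁺ lt x (sortBy lt ys) (here refl)
∈-sortBy⁺ lt (x ∷ ys) (there y∈)  = ∈-insertBy⁺ lt x (sortBy lt ys) (there (∈-sortBy⁺ lt ys y∈))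

module _ (lt : ℕ → ℕ → Bool)
         (asym : ∀ x y → T (lt x y) → ¬ T (lt y x))
         (ltrans : ∀ x y z → T (lt x y) → T (lt y z) → T (lt x z)) where

  insertBy-Sorted : ∀ x ys → Sorted lt ys → Sorted lt (insertBy lt x ys)
  insertBy-Sorted x []       _          = [] ∷ []
  insertBy-Sorted x (y ∷ ys) (y≤ ∷ srt) with lt x y in eq
  ... | true  = (¬T⇒false (asym x y x<y) ∷ All.map (λ {z} z≮y → ¬T⇒false (λ z<x → subst T z≮y (ltrans z x y z<x x<y))) y≤) ∷ y≤ ∷ srt
    where
    x<y : T (lt x y)
    x<y = subst T (sym eq) tt
  ... | false = All.tabulate y≤′ ∷ insertBy-Sorted x ys srt
    where
    y≤′ : ∀ {z} → z ∈ insertBy lt x ys → lt z y ≡ false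
    y≤′ z∈ with ∈-insertBy⁻ lt x ys z∈
    ... | here refl = eq
    ... | there z∈′ = All.lookup y≤ z∈′

  sortBy-Sorted : ∀ ys → Sorted lt (sortBy lt ys)
  sortBy-Sorted []       = []
  sortBy-Sorted (y ∷ ys) = insertBy-Sorted y (sortBy lt ys) (sortBy-Sorted ys)

∈-∷-≢ : ∀ {x z : ℕ} {ws} → x ∈ z ∷ ws → (x ≡ᵇ z) ≡ false → x ∈ ws
∈-∷-≢ {x} (here refl) eq = contradiction (trans (sym (≡ᵇ-refl x)) eq) (λ ())
∈-∷-≢     (there x∈)  eq = x∈

Sorted⇒posℕ-< : ∀ lt w {x y} → Sorted lt w → x ∈ w → y ∈ w → x ≢ y → T (lt x y) → posℕ x w < posℕ y w
Sorted⇒posℕ-< lt (z ∷ ws) {x} {y} (z≤ ∷ srt) x∈ y∈ x≢y x<y with x ≡ᵇ z in xz | y ≡ᵇ z in yz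
... | true  | true  = contradiction (trans (≡ᵇ⇒≡ x z (subst T (sym xz) tt)) (sym (≡ᵇ⇒≡ y z (subst T (sym yz) tt)))) x≢y
... | true  | false = s≤s z≤n
... | false | false = s≤s (Sorted⇒posℕ-< lt ws srt (∈-∷-≢ x∈ xz) (∈-∷-≢ y∈ yz) x≢y x<y)
... | false | true with ≡ᵇ⇒≡ y z (subst T (sym yz) tt)
... | refl = contradiction x<y (subst (¬_ ∘ T) (sym (All.lookup z≤ (∈-∷-≢ x∈ xz))) (λ ()))

Sorted⇒posℕ-<ᵇ : ∀ lt w {x y} → Sorted lt w → x ∈ w → y ∈ w → x ≢ y → lt x y ≡ not (lt y x) →
  (posℕ y w <ᵇ posℕ x w) ≡ lt y x
Sorted⇒posℕ-<ᵇ lt w {x} {y} srt x∈ y∈ x≢y tot with lt y x in eq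
... | true  = <⇒<ᵇ-true (Sorted⇒posℕ-< lt w srt y∈ x∈ (x≢y ∘ sym) (subst T (sym eq) tt))
... | false = ≤⇒<ᵇ-false (<⇒≤ (Sorted⇒posℕ-< lt w srt x∈ y∈ x≢y (subst T (sym tot) tt)))

filterᵇ-from1 : ∀ q m c → length c ≡ m → (∀ i → i < m → bit c i ≡ q (suc i)) → filterᵇ q (from1 m) ≡ indices 1 c
filterᵇ-from1 q m c len eq rewrite from1≡range m | range-indices 1 m =
  filterᵇ-indices q 1 trues c (trans len (sym (length-applyUpTo (λ _ → true) m))) eq′
  where
  trues : List Bool
  trues = applyUpTo (λ _ → true) m
  eq′ : ∀ i → bit c i ≡ bit trues i ∧ q (suc i)
  eq′ i with i <? m
  ... | yes i<m rewrite bit-all m i i<m = eq i i<m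
  ... | no  i≮m = trans (¬T⇒false (λ t → i≮m (subst (i <_) len (bit⇒< c i t))))
                        (sym (cong (_∧ q (suc i)) (¬T⇒false (λ t →
                          i≮m (subst (i <_) (length-applyUpTo (λ _ → true) m) (bit⇒< trues i t))))))

∈-from1⁺ : ∀ n i → i < n → suc i ∈ from1 n
∈-from1⁺ n i i<n = ∈-applyUpTo⁺ suc i<n

-- Serves both descent sets: the reading word with the order of heads, and the marked word with
-- `markedLt`.
wordDes-Sorted : ∀ lt n w c → Sorted lt w → (∀ {x} → x ∈ from1 n → x ∈ w) → length c ≡ n ∸ 1 →
  (∀ i → suc i < n → lt (suc i) (2 + i) ≡ not (lt (2 + i) (suc i)) × lt (2 + i) (suc i) ≡ bit c i) →
  wordDes n w ≡ indices 1 c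
wordDes-Sorted lt zero    w [] srt cov len eq = refl
wordDes-Sorted lt (suc n) w c  srt cov len eq = filterᵇ-from1 _ n c len (λ i i<n →
  sym (trans (Sorted⇒posℕ-<ᵇ lt w srt (cov (∈-from1⁺ (suc n) i (m<n⇒m<1+n i<n)))
                                      (cov (∈-from1⁺ (suc n) (suc i) (s≤s i<n)))
                                      (<⇒≢ ≤-refl) (proj₁ (eq i (s≤s i<n))))
             (proj₂ (eq i (s≤s i<n)))))

readsBefore⁻ : ∀ x y → T (readsBefore x y) → row y < row x ⊎ (row x ≡ row y × col x < col y)
readsBefore⁻ (a , b) (c , d) t with Equivalence.to (T-∨ {d <ᵇ b}) t
... | inj₁ u = inj₁ (<ᵇ⇒< d b u)
... | inj₂ u with T-∧⁻ {b ≡ᵇ d} u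
... | v , w = inj₂ (≡ᵇ⇒≡ b d v , <ᵇ⇒< a c w)

readsBefore⁺ : ∀ x y → row y < row x ⊎ (row x ≡ row y × col x < col y) → T (readsBefore x y)
readsBefore⁺ (a , b) (c , d) (inj₁ u)       = Equivalence.from T-∨ (inj₁ (<⇒<ᵇ u))
readsBefore⁺ (a , b) (c , d) (inj₂ (v , w)) =
  Equivalence.from (T-∨ {d <ᵇ b}) (inj₂ (Equivalence.from T-∧ (≡⇒≡ᵇ b d v , <⇒<ᵇ w)))

readsBefore-asym : ∀ x y → T (readsBefore x y) → ¬ T (readsBefore y x)
readsBefore-asym x y s t with readsBefore⁻ x y s | readsBefore⁻ y x t
... | inj₁ u       | inj₁ v       = <-asym u v
... | inj₁ u       | inj₂ (e , _) = <-irrefl e u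
... | inj₂ (e , _) | inj₁ v       = <-irrefl e v
... | inj₂ (_ , u) | inj₂ (_ , v) = <-asym u v

readsBefore-trans : ∀ x y z → T (readsBefore x y) → T (readsBefore y z) → T (readsBefore x z)
readsBefore-trans x y z s t = readsBefore⁺ x z (go (readsBefore⁻ x y s) (readsBefore⁻ y z t))
  where
  go : row y < row x ⊎ (row x ≡ row y × col x < col y) → row z < row y ⊎ (row y ≡ row z × col y < col z) →
    row z < row x ⊎ (row x ≡ row z × col x < col z)
  go (inj₁ u)       (inj₁ v)       = inj₁ (<-trans v u)
  go (inj₁ u)       (inj₂ (e , _)) = inj₁ (subst (_< row x) e u)
  go (inj₂ (e , _)) (inj₁ v)       = inj₁ (subst (row z <_) (sym e) v)
  go (inj₂ (e , u)) (inj₂ (f , v)) = inj₂ (trans e f , <-trans u v)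

-- The order of the marked word: marked labels first, in reversed order, then the unmarked ones in
-- the order `lt`.
markedLt : (ℕ → Bool) → (ℕ → ℕ → Bool) → ℕ → ℕ → Bool
markedLt μ lt x y = if μ x then (if μ y then lt y x else true) else (if μ y then false else lt x y)

module _ {A : Set} {R S : A → A → Set} where

  AllPairs-map-∈ : ∀ {xs} → (∀ {x y} → x ∈ xs → y ∈ xs → R x y → S x y) → AllPairs R xs → AllPairs S xs
  AllPairs-map-∈ f []       = []
  AllPairs-map-∈ f (r ∷ rs) =
    All.tabulate (λ y∈ → f (here refl) (there y∈) (All.lookup r y∈)) ∷ AllPairs-map-∈ (λ x∈ y∈ → f (there x∈) (there y∈)) rs

AllPairs-reverse : {A : Set} {R : A → A → Set} (xs : List A) → AllPairs R xs → AllPairs (flip R) (reverse xs)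
AllPairs-reverse []       []       = []
AllPairs-reverse {R = R} (x ∷ xs) (r ∷ rs) = subst (AllPairs (flip R)) (sym (unfold-reverse x xs))
  (AllPairs.++⁺ (AllPairs-reverse xs rs) ([] ∷ []) (All.tabulate (λ y∈ → All.lookup r (reverse⁻ y∈) ∷ [])))

T-not⇒false : ∀ {b} → T (not b) → b ≡ false
T-not⇒false = Equivalence.to T-not-≡

markedWord-Sorted : ∀ μ lt w → Sorted lt w →
  Sorted (markedLt μ lt) (reverse (filterᵇ μ w) ++ filterᵇ (not ∘ μ) w)
markedWord-Sorted μ lt w srt = AllPairs.++⁺
  (AllPairs-map-∈ (λ x∈ y∈ → both-marked (marked (reverse⁻ x∈)) (marked (reverse⁻ y∈)))
    (AllPairs-reverse (filterᵇ μ w) (AllPairs.filter⁺ (T? ∘ μ) srt)))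
  (AllPairs-map-∈ (λ x∈ y∈ → both-unmarked (unmarked x∈) (unmarked y∈))
    (AllPairs.filter⁺ (T? ∘ not ∘ μ) srt))
  (All.tabulate (λ x∈ → All.tabulate (λ y∈ → cross (marked (reverse⁻ x∈)) (unmarked y∈))))
  where
  marked : ∀ {x} → x ∈ filterᵇ μ w → μ x ≡ true
  marked x∈ = T⇒true (proj₂ (∈-filterᵇ⁻ μ w x∈))
  unmarked : ∀ {x} → x ∈ filterᵇ (not ∘ μ) w → μ x ≡ false
  unmarked x∈ = T-not⇒false (proj₂ (∈-filterᵇ⁻ (not ∘ μ) w x∈))
  both-marked : ∀ {x y} → μ x ≡ true → μ y ≡ true → lt x y ≡ false → markedLt μ lt y x ≡ false
  both-marked mx my eq rewrite mx | my = eq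
  both-unmarked : ∀ {x y} → μ x ≡ false → μ y ≡ false → lt y x ≡ false → markedLt μ lt y x ≡ false
  both-unmarked mx my eq rewrite mx | my = eq
  cross : ∀ {x y} → μ x ≡ true → μ y ≡ false → markedLt μ lt y x ≡ false
  cross mx my rewrite mx | my = refl

∈-markedWord : ∀ (μ : ℕ → Bool) w {x} → x ∈ w → x ∈ reverse (filterᵇ μ w) ++ filterᵇ (not ∘ μ) w
∈-markedWord μ w {x} x∈ with μ x in eq
... | true  = ∈-++⁺ˡ (reverse⁺ (∈-filterᵇ⁺ μ x∈ (subst T (sym eq) tt)))
... | false = ∈-++⁺ʳ (reverse (filterᵇ μ w)) (∈-filterᵇ⁺ (not ∘ μ) x∈ (subst (T ∘ not) (sym eq) tt))

-- Descents of tableaux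

descents : List Cell → List Bool
descents (h ∷ h′ ∷ hs) = readsBefore h′ h ∷ descents (h′ ∷ hs)
descents _             = []

length-descents : ∀ hs → length (descents hs) ≡ length hs ∸ 1
length-descents []            = refl
length-descents (h ∷ [])      = refl
length-descents (h ∷ h′ ∷ hs) = cong suc (length-descents (h′ ∷ hs))

bit-descents : ∀ hs i → suc i < length hs → bit (descents hs) i ≡ readsBefore (nth hs (2 + i)) (nth hs (suc i))
bit-descents (h ∷ h′ ∷ hs) zero    _       = refl
bit-descents (h ∷ [])      i       (s≤s ())
bit-descents (h ∷ h′ ∷ hs) (suc i) (s≤s l) = bit-descents (h′ ∷ hs) i l

length-markedDescents : ∀ b ds → length ds ≡ length b ∸ 1 → length (markedDescents b ds) ≡ length b ∸ 1
length-markedDescents []           ds       len = refl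
length-markedDescents (m ∷ [])     ds       len = refl
length-markedDescents (m ∷ m′ ∷ b) (d ∷ ds) len = cong suc (length-markedDescents (m′ ∷ b) ds (suc-injective len))

bit-markedDescents : ∀ b ds i → length ds ≡ length b ∸ 1 → suc i < length b →
  bit (markedDescents b ds) i ≡ markedDescent (bit b i) (bit b (suc i)) (bit ds i)
bit-markedDescents (m ∷ [])     ds       i       len (s≤s ())
bit-markedDescents (m ∷ m′ ∷ b) (d ∷ ds) zero    len l       = refl
bit-markedDescents (m ∷ m′ ∷ b) (d ∷ ds) (suc i) len (s≤s l) = bit-markedDescents (m′ ∷ b) ds i (suc-injective len) l

Linked-nth : ∀ {R : Cell → Cell → Set} hs → Linked R hs → ∀ i → suc i < length hs → R (nth hs (suc i)) (nth hs (2 + i))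
Linked-nth (h ∷ h′ ∷ hs) (r ∷ rs) zero    _       = r
Linked-nth (h ∷ [])      _        i       (s≤s ())
Linked-nth (h ∷ h′ ∷ hs) (r ∷ rs) (suc i) (s≤s l) = Linked-nth (h′ ∷ hs) rs i l

length-headsFrom : ∀ k p ps → length (headsFrom k p ps) ≡ length ps
length-headsFrom k p []       = refl
length-headsFrom k p (q ∷ ps) = cong suc (length-headsFrom k q ps)

Strict : Part → Set
Strict p = T (isStrictPartition p)

isJust⇒just : ∀ m → T (isJust m) → m ≡ just (fromMaybeC m)
isJust⇒just (just _) _ = refl

validSteps⇒Linked : ∀ k p ps → Strict p → All Strict ps → T (validSteps k p ps) →
  Linked Consecutive (headsFrom k p ps)
validSteps⇒Linked k p []           sp sps v = []
validSteps⇒Linked k p (q ∷ [])     sp sps v = [-]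
validSteps⇒Linked k p (q ∷ r ∷ ps) sp (sq ∷ sr ∷ sps) v =
  consecutiveHeads k p q r sp sq sr
    (isJust⇒just _ (proj₁ (T-∧⁻ {isJust (stepHead k p q)} v)))
    (isJust⇒just _ (proj₁ (T-∧⁻ {isJust (stepHead k q r)} (proj₂ (T-∧⁻ {isJust (stepHead k p q)} v)))))
  ∷ validSteps⇒Linked k q (r ∷ ps) sq (sr ∷ sps) (proj₂ (T-∧⁻ {isJust (stepHead k p q)} v))

module ValidChain (k : ℕ) (p : Part) (ps : List Part) (linked : Linked Consecutive (headsFrom k p ps)) where

  private
    hs : List Cell
    hs = headsFrom k p ps
    n : ℕ
    n = length ps
    lt : ℕ → ℕ → Bool
    lt i j = readsBefore (nth hs i) (nth hs j)
    w : List ℕ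
    w = readingWord k (p ∷ ps)
    w-Sorted : Sorted lt w
    w-Sorted = sortBy-Sorted lt (λ i j → readsBefore-asym (nth hs i) (nth hs j))
      (λ i j l → readsBefore-trans (nth hs i) (nth hs j) (nth hs l)) (from1 n)
    <length-hs : ∀ {i} → i < n → i < length hs
    <length-hs {i} = subst (i <_) (sym (length-headsFrom k p ps))
    lt-total : ∀ i → suc i < n → lt (suc i) (2 + i) ≡ not (lt (2 + i) (suc i))
    lt-total i i<n = proj₂ (proj₂ (Linked-nth hs linked i (<length-hs i<n)))
    lt-bit : ∀ i → suc i < n → lt (2 + i) (suc i) ≡ bit (descents hs) i
    lt-bit i i<n = sym (bit-descents hs i (<length-hs i<n))

  length-ds : length (descents hs) ≡ n ∸ 1
  length-ds = trans (length-descents hs) (cong (_∸ 1) (length-headsFrom k p ps))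

  Des≡ : Des k (p ∷ ps) ≡ indices 1 (descents hs)
  Des≡ = wordDes-Sorted lt n w (descents hs) w-Sorted (∈-sortBy⁺ lt (from1 n)) length-ds
    (λ i i<n → lt-total i i<n , lt-bit i i<n)

  DesMarked≡ : ∀ b → length b ≡ n → DesMarked k (p ∷ ps , indices 1 b) ≡ indices 1 (markedDescents b (descents hs))
  DesMarked≡ b len = wordDes-Sorted (markedLt μ lt) n (markedWord k (p ∷ ps , indices 1 b)) (markedDescents b (descents hs))
    (markedWord-Sorted μ lt w w-Sorted) (λ x∈ → ∈-markedWord μ w (∈-sortBy⁺ lt (from1 n) x∈))
    (trans (length-markedDescents b (descents hs) length-ds′) (cong (_∸ 1) len))
    eq
    where
    μ : ℕ → Bool
    μ x = elemℕ x (indices 1 b)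
    length-ds′ : length (descents hs) ≡ length b ∸ 1
    length-ds′ = trans length-ds (cong (_∸ 1) (sym len))
    eq : ∀ i → suc i < n → markedLt μ lt (suc i) (2 + i) ≡ not (markedLt μ lt (2 + i) (suc i)) ×
      markedLt μ lt (2 + i) (suc i) ≡ bit (markedDescents b (descents hs)) i
    eq i i<n
      rewrite bit-markedDescents b (descents hs) i length-ds′ (subst (suc i <_) (sym len) i<n)
            | elemℕ-indices 1 i b | elemℕ-indices 1 (suc i) b | sym (lt-bit i i<n) | lt-total i i<n
      -- The truth table behind `markedDescent`: two unmarked labels keep their order, two marked
      -- ones exchange it, and a single marked label comes first.
      with bit b i | bit b (suc i) | lt (2 + i) (suc i)
    ... | false | false | false = refl , refl
    ... | false | false | true  = refl , refl
    ... | false | true  | false = refl , refl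
    ... | false | true  | true  = refl , refl
    ... | true  | false | false = refl , refl
    ... | true  | false | true  = refl , refl
    ... | true  | true  | false = refl , refl
    ... | true  | true  | true  = refl , refl

-- Labels j′, j coded as 2 j - 1, 2 j

-- Stands in for `2 * n`, because it unfolds two constructors at a time, as `isOdd` does.
dbl : ℕ → ℕ
dbl zero    = zero
dbl (suc n) = suc (suc (dbl n))

2*≡dbl : ∀ n → 2 * n ≡ dbl n
2*≡dbl zero    = refl
2*≡dbl (suc n) = trans (*-suc 2 n) (cong (suc ∘ suc) (2*≡dbl n))

code : ℕ → Bool → ℕ
code j marked = if marked then dbl j ∸ 1 else dbl j

dbl-<ᵇ : ∀ x y → (dbl x <ᵇ dbl y) ≡ (x <ᵇ y)
dbl-<ᵇ zero    zero    = refl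
dbl-<ᵇ zero    (suc y) = refl
dbl-<ᵇ (suc x) zero    = refl
dbl-<ᵇ (suc x) (suc y) = dbl-<ᵇ x y

dbl-≡ᵇ : ∀ x y → (dbl x ≡ᵇ dbl y) ≡ (x ≡ᵇ y)
dbl-≡ᵇ zero    zero    = refl
dbl-≡ᵇ zero    (suc y) = refl
dbl-≡ᵇ (suc x) zero    = refl
dbl-≡ᵇ (suc x) (suc y) = dbl-≡ᵇ x y

suc-dbl-<ᵇ-dbl : ∀ x y → (suc (dbl x) <ᵇ dbl y) ≡ (x <ᵇ y)
suc-dbl-<ᵇ-dbl zero    zero    = refl
suc-dbl-<ᵇ-dbl zero    (suc y) = refl
suc-dbl-<ᵇ-dbl (suc x) zero    = refl
suc-dbl-<ᵇ-dbl (suc x) (suc y) = suc-dbl-<ᵇ-dbl x y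

dbl-<ᵇ-suc-dbl : ∀ x y → (dbl x <ᵇ suc (dbl y)) ≡ (x <ᵇ suc y)
dbl-<ᵇ-suc-dbl zero    zero    = refl
dbl-<ᵇ-suc-dbl zero    (suc y) = refl
dbl-<ᵇ-suc-dbl (suc x) zero    = refl
dbl-<ᵇ-suc-dbl (suc x) (suc y) = dbl-<ᵇ-suc-dbl x y

suc-dbl-≢ᵇ-dbl : ∀ x y → (suc (dbl x) ≡ᵇ dbl y) ≡ false
suc-dbl-≢ᵇ-dbl zero    zero    = refl
suc-dbl-≢ᵇ-dbl zero    (suc y) = refl
suc-dbl-≢ᵇ-dbl (suc x) zero    = refl
suc-dbl-≢ᵇ-dbl (suc x) (suc y) = suc-dbl-≢ᵇ-dbl x y

isOdd-dbl : ∀ x → isOdd (dbl x) ≡ false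
isOdd-dbl zero    = refl
isOdd-dbl (suc x) = isOdd-dbl x

isOdd-suc-dbl : ∀ x → isOdd (suc (dbl x)) ≡ true
isOdd-suc-dbl zero    = refl
isOdd-suc-dbl (suc x) = isOdd-suc-dbl x

-- Trades "smaller, or equal with permission d" for a weak increase that must be strict when d is
-- false; `x <ᵇ suc y` is x ≤ y.
<ᵇ∨≡ᵇ : ∀ x y d → (x <ᵇ y) ∨ ((x ≡ᵇ y) ∧ d) ≡ (x <ᵇ suc y) ∧ (d ∨ (x <ᵇ y))
<ᵇ∨≡ᵇ zero    zero    false = refl
<ᵇ∨≡ᵇ zero    zero    true  = refl
<ᵇ∨≡ᵇ zero    (suc y) false = refl
<ᵇ∨≡ᵇ zero    (suc y) true  = refl
<ᵇ∨≡ᵇ (suc x) zero    d     = refl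
<ᵇ∨≡ᵇ (suc x) (suc y) d     = <ᵇ∨≡ᵇ x y d

-- On equal values, i′ followed by i is always allowed and i followed by i′ never; two marked labels
-- need d, two unmarked ones need its negation. In all four cases equality is allowed exactly when
-- there is no marked descent.
compat-code : ∀ x y m m′ d {r c} → r ≡ d → c ≡ not d →
  (code (suc x) m <ᵇ code (suc y) m′) ∨
    ((code (suc x) m ≡ᵇ code (suc y) m′) ∧ (if isOdd (code (suc y) m′) then r else c)) ≡
  (suc x ≤ᵇ suc y) ∧ (not (markedDescent m m′ d) ∨ (suc x <ᵇ suc y))
compat-code x y true true d refl refl
  rewrite dbl-<ᵇ x y | dbl-≡ᵇ x y | isOdd-suc-dbl y with d
... | true  = <ᵇ∨≡ᵇ x y true
... | false = <ᵇ∨≡ᵇ x y false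
compat-code x y true false d refl refl
  rewrite dbl-<ᵇ-suc-dbl x y | ≡ᵇ-sym (dbl x) (suc (dbl y)) | suc-dbl-≢ᵇ-dbl y x with d | x <ᵇ suc y
... | true  | true  = refl
... | true  | false = refl
... | false | true  = refl
... | false | false = refl
compat-code x y false true d refl refl
  rewrite suc-dbl-<ᵇ-dbl x y | suc-dbl-≢ᵇ-dbl x y with d
... | true  = trans (cong ((x <ᵇ y) ∨_) (sym (∧-zeroʳ (x ≡ᵇ y)))) (<ᵇ∨≡ᵇ x y false)
... | false = trans (cong ((x <ᵇ y) ∨_) (sym (∧-zeroʳ (x ≡ᵇ y)))) (<ᵇ∨≡ᵇ x y false)
compat-code x y false false d refl refl
  rewrite dbl-<ᵇ x y | dbl-≡ᵇ x y | isOdd-dbl y with d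
... | true  = <ᵇ∨≡ᵇ x y false
... | false = <ᵇ∨≡ᵇ x y true

stripCompat-code : ∀ x y m m′ h h′ → Consecutive h h′ →
  stripCompat (just (code (suc x) m , h)) (code (suc y) m′) h′ ≡
  (suc x ≤ᵇ suc y) ∧ (not (markedDescent m m′ (readsBefore h′ h)) ∨ (suc x <ᵇ suc y))
stripCompat-code x y m m′ h h′ (row≡ , col≡ , _) = compat-code x y m m′ (readsBefore h′ h) row≡ col≡

code-match : ∀ j x m → ((code (suc x) m ≡ᵇ 2 * suc j ∸ 1) ∨ (code (suc x) m ≡ᵇ 2 * suc j)) ≡ (j ≡ᵇ x)
code-match j x m = trans (cong (λ z → (code (suc x) m ≡ᵇ z ∸ 1) ∨ (code (suc x) m ≡ᵇ z)) (2*≡dbl (suc j))) (by-mark m)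
  where
  by-mark : ∀ m → ((code (suc x) m ≡ᵇ suc (dbl j)) ∨ (code (suc x) m ≡ᵇ dbl (suc j))) ≡ (j ≡ᵇ x)
  by-mark true  rewrite ≡ᵇ-sym (dbl x) (suc (dbl j)) | suc-dbl-≢ᵇ-dbl j x | dbl-≡ᵇ x j | ≡ᵇ-sym x j = ∨-identityʳ (j ≡ᵇ x)
  by-mark false rewrite suc-dbl-≢ᵇ-dbl x j | dbl-≡ᵇ x j = ≡ᵇ-sym x j

-- The code of j′ precedes that of j, whereas `bools` begins with the unmarked value; hence the
-- commutation of the two terms.
∑-from1-code : ∀ n (F : ℕ → ℕ) → ∑ (from1 (2 * n)) F ≡ ∑ (from1 n) (λ j → ∑ bools (λ m → F (code j m)))
∑-from1-code n F rewrite 2*≡dbl n | from1≡range (dbl n) | from1≡range n = go 0 n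
  where
  go : ∀ j n → ∑ (range (suc (dbl j)) (dbl n)) F ≡ ∑ (range (suc j) n) (λ j → ∑ bools (λ m → F (code j m)))
  go j zero    = refl
  go j (suc n) = trans (sym (+-assoc (F (suc (dbl j))) _ _))
    (cong₂ _+_ (trans (+-comm (F (suc (dbl j))) _) (cong (F (suc (suc (dbl j))) +_) (sym (+-identityʳ _)))) (go (suc j) n))

-- Semi-standard tableaux with a given underlying chain

stripsCompat : Maybe (ℕ × Cell) → List Cell → List ℕ → Bool
stripsCompat prev (h ∷ hs) (c ∷ cs) = stripCompat prev c h ∧ stripsCompat (just (c , h)) hs cs
stripsCompat prev _        _        = true

∧-regroup : ∀ a {b c} s {r v z} → b ≡ true → c ≡ true → r ≡ v ∧ z → a ∧ b ∧ c ∧ s ∧ r ≡ (a ∧ v) ∧ (s ∧ z)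
∧-regroup false _ _ _ = λ _ → refl
∧-regroup true  false {v = true}  refl refl refl = refl
∧-regroup true  false {v = false} refl refl refl = refl
∧-regroup true  true  refl refl refl = refl

∈-from1⁻ : ∀ n {x} → x ∈ from1 n → ∃ λ i → i < n × x ≡ suc i
∈-from1⁻ n = ∈-applyUpTo⁻ suc

-- The codes are drawn from the admissible range, so the range tests hold and the remaining tests
-- concern either the shapes or the labels along their heads.
ssSteps-split : ∀ k m p prev ps cs → length cs ≡ length ps → All (_∈ from1 (2 * m)) cs →
  ssSteps k m p prev (zipWith _,_ ps cs) ≡ validSteps k p ps ∧ stripsCompat prev (headsFrom k p ps) cs
ssSteps-split k m p prev []       []       len []         = refl
ssSteps-split k m p prev (q ∷ ps) (c ∷ cs) len (c∈ ∷ cs∈) with ∈-from1⁻ (2 * m) c∈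
... | i , i< , refl = ∧-regroup (isJust (stepHead k p q)) (stripCompat prev (suc i) _) refl (T⇒true (≤⇒≤ᵇ i<))
  (ssSteps-split k m q _ ps cs (suc-injective len) cs∈)

lastPartL-zip : ∀ p ps (cs : List ℕ) → length cs ≡ length ps → lastPartL p (zipWith _,_ ps cs) ≡ lastPart p ps
lastPartL-zip p []       []       len = refl
lastPartL-zip p (q ∷ ps) (c ∷ cs) len = lastPartL-zip q ps cs (suc-injective len)

all-cong-∈ : {A : Set} {f g : A → Bool} (xs : List A) → (∀ {x} → x ∈ xs → f x ≡ g x) → all f xs ≡ all g xs
all-cong-∈ []       eq = refl
all-cong-∈ (x ∷ xs) eq = cong₂ _∧_ (eq (here refl)) (all-cong-∈ xs (eq ∘ there))

all-true : {A : Set} (xs : List A) → all (λ _ → true) xs ≡ true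
all-true []       = refl
all-true (x ∷ xs) = all-true xs

count-code : ∀ m j (ps : List Part) s b → length s ≡ length ps → length b ≡ length ps → All (_∈ from1 m) s →
  length (filterᵇ (λ st → (proj₂ st ≡ᵇ (2 * suc j ∸ 1)) ∨ (proj₂ st ≡ᵇ 2 * suc j)) (zipWith _,_ ps (zipWith code s b))) ≡
  countℕ (suc j) s
count-code m j []       []      []       ls lb []       = refl
count-code m j (q ∷ ps) (x ∷ s) (m′ ∷ b) ls lb (x∈ ∷ s∈) with ∈-from1⁻ m x∈
... | i , _ , refl rewrite code-match j i m′ with j ≡ᵇ i
... | true  = cong suc (count-code m j ps s b (suc-injective ls) (suc-injective lb) s∈)
... | false = count-code m j ps s b (suc-injective ls) (suc-injective lb) s∈

ssContent-code : ∀ α ps s b → length s ≡ length ps → length b ≡ length ps → All (_∈ from1 (length α)) s →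
  ssContent α (zipWith _,_ ps (zipWith code s b)) ≡ hasContent α s
ssContent-code α ps s b ls lb s∈ = trans
  (all-cong-∈ (from1 (length α)) (λ j∈ → eq j∈))
  (sym (trans (cong (content ∧_) (trans (all-cong-∈ s inRange) (all-true s))) (∧-identityʳ content)))
  where
  content : Bool
  content = all (λ j → countℕ j s ≡ᵇ nthℕ α j) (from1 (length α))
  eq : ∀ {j} → j ∈ from1 (length α) →
    (length (filterᵇ (λ st → (proj₂ st ≡ᵇ (2 * j ∸ 1)) ∨ (proj₂ st ≡ᵇ 2 * j)) (zipWith _,_ ps (zipWith code s b))) ≡ᵇ nthℕ α j) ≡
    (countℕ j s ≡ᵇ nthℕ α j)
  eq j∈ with ∈-from1⁻ (length α) j∈
  ... | j , _ , refl = cong (_≡ᵇ nthℕ α (suc j)) (count-code (length α) j ps s b ls lb s∈)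
  inRange : ∀ {v} → v ∈ s → ((1 ≤ᵇ v) ∧ (v ≤ᵇ length α)) ≡ true
  inRange v∈ with ∈-from1⁻ (length α) (All.lookup s∈ v∈)
  ... | i , i< , refl = T⇒true (≤⇒≤ᵇ i<)

code-∈ : ∀ m j b → j ∈ from1 m → code j b ∈ from1 (2 * m)
code-∈ m j b j∈ with ∈-from1⁻ m j∈
... | i , i<m , refl = subst (code (suc i) b ∈_) (sym (cong from1 (2*≡dbl m))) (∈-applyUpTo-code b)
  where
  dbl-< : ∀ {i m} → i < m → suc (dbl i) < dbl m
  dbl-< {zero}  {suc m} _         = s≤s (s≤s z≤n)
  dbl-< {suc i} {suc m} (s≤s i<m) = s≤s (s≤s (dbl-< i<m))
  ∈-applyUpTo-code : ∀ b → code (suc i) b ∈ from1 (dbl m)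
  ∈-applyUpTo-code true  = ∈-from1⁺ (dbl m) (dbl i) (<-trans ≤-refl (dbl-< i<m))
  ∈-applyUpTo-code false = ∈-from1⁺ (dbl m) (suc (dbl i)) (dbl-< i<m)

zipWith-code-∈ : ∀ m s b → All (_∈ from1 m) s → All (_∈ from1 (2 * m)) (zipWith code s b)
zipWith-code-∈ m []      b       []       = []
zipWith-code-∈ m (x ∷ s) []      _        = []
zipWith-code-∈ m (x ∷ s) (c ∷ b) (x∈ ∷ s∈) = code-∈ m x c x∈ ∷ zipWith-code-∈ m s b s∈

length-zipWith-≡ : {A B C : Set} (g : A → B → C) (xs : List A) (ys : List B) {n : ℕ} →
  length xs ≡ n → length ys ≡ n → length (zipWith g xs ys) ≡ n
length-zipWith-≡ g xs ys {n} lx ly = trans (length-zipWith g xs ys) (trans (cong₂ _⊓_ lx ly) (⊓-idem n))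

-- The conditions on the shapes are those of a standard tableau, so the labels can be counted
-- separately over each chain.
isSSTableau-split : ∀ k la α p ps s b → length s ≡ length ps → length b ≡ length ps → All (_∈ from1 (length α)) s →
  isSSTableau k la α (p , zipWith _,_ ps (zipWith code s b)) ≡
  isStdTableau k la (p ∷ ps) ∧ (stripsCompat nothing (headsFrom k p ps) (zipWith code s b) ∧ hasContent α s)
isSSTableau-split k la α p ps s b ls lb s∈
  rewrite ssSteps-split k (length α) p nothing ps (zipWith code s b) (length-zipWith-≡ code s b ls lb) (zipWith-code-∈ _ s b s∈)
        | lastPartL-zip p ps (zipWith code s b) (length-zipWith-≡ code s b ls lb)
        | ssContent-code α ps s b ls lb s∈ =
  regroup (isStrictPartition la) (isCore k p) (validSteps k p ps) (isStrictPartition (lastPart p ps))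
          (subsetC (cells (lastPart p ps)) (cells la)) (subsetC (cells la) (cells (lastPart p ps)))
  where
  regroup : ∀ a b v l s₁ s₂ {w c} → a ∧ b ∧ (v ∧ w) ∧ l ∧ (s₁ ∧ s₂) ∧ c ≡ (a ∧ b ∧ v ∧ (l ∧ s₁ ∧ s₂)) ∧ (w ∧ c)
  regroup false b v l s₁ s₂ = refl
  regroup true false v l s₁ s₂ = refl
  regroup true true false l s₁ s₂ = refl
  regroup true true true false s₁ s₂ {w} = ∧-zeroʳ w
  regroup true true true true false s₂ {w} = ∧-zeroʳ w
  regroup true true true true true false {w} = ∧-zeroʳ w
  regroup true true true true true true = refl

-- Strip conditions as the inequalities that define F

increasesAt : List Bool → List ℕ → Bool
increasesAt e s = all (λ t → nthℕ s t <ᵇ nthℕ s (suc t)) (indices 1 e)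

indices-suc : ∀ j b → indices (suc j) b ≡ map suc (indices j b)
indices-suc j []          = refl
indices-suc j (true  ∷ b) = cong (suc j ∷_) (indices-suc (suc j) b)
indices-suc j (false ∷ b) = indices-suc (suc j) b

all-map : {A B : Set} (f : B → Bool) (g : A → B) (xs : List A) → all f (map g xs) ≡ all (f ∘ g) xs
all-map f g []       = refl
all-map f g (x ∷ xs) = cong (f (g x) ∧_) (all-map f g xs)

increasesAt-∷ : ∀ e es x y s → increasesAt (e ∷ es) (x ∷ y ∷ s) ≡ (not e ∨ (x <ᵇ y)) ∧ increasesAt es (y ∷ s)
increasesAt-∷ e es x y s = by-head e
  where
  f : ℕ → Bool
  f t = nthℕ (x ∷ y ∷ s) t <ᵇ nthℕ (x ∷ y ∷ s) (suc t)
  tail≡ : all f (indices 2 es) ≡ increasesAt es (y ∷ s)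
  -- `nthℕ` shifts along the list only at positive places; writing the places as successors of
  -- `indices 0 es` lets it reduce.
  tail≡ rewrite indices-suc 1 es | indices-suc 0 es =
    trans (all-map f suc (map suc (indices 0 es)))
      (trans (all-map (f ∘ suc) suc (indices 0 es)) (sym (all-map _ suc (indices 0 es))))
  by-head : ∀ e → increasesAt (e ∷ es) (x ∷ y ∷ s) ≡ (not e ∨ (x <ᵇ y)) ∧ increasesAt es (y ∷ s)
  by-head true  = cong ((x <ᵇ y) ∧_) tail≡
  by-head false = tail≡

∧-interchange : ∀ a b c d → (a ∧ b) ∧ (c ∧ d) ≡ (a ∧ c) ∧ (b ∧ d)
∧-interchange false b     c     d = refl
∧-interchange true  false false d = refl
∧-interchange true  false true  d = refl
∧-interchange true  true  c     d = refl

stripsCompat-code : ∀ m hs s b → Linked Consecutive hs → length s ≡ length hs → length b ≡ length hs → All (_∈ from1 m) s →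
  stripsCompat nothing hs (zipWith code s b) ≡ weaklyIncreasing s ∧ increasesAt (markedDescents b (descents hs)) s
stripsCompat-code m []            []          []           _        ls lb _ = refl
stripsCompat-code m (h ∷ [])      (x ∷ [])    (b ∷ [])     _        ls lb _ = refl
stripsCompat-code m (h ∷ h′ ∷ hs) (x ∷ y ∷ s) (b ∷ b′ ∷ bs) (r ∷ rs) ls lb (x∈ ∷ y∈ ∷ s∈)
  rewrite increasesAt-∷ (markedDescent b b′ (readsBefore h′ h)) (markedDescents (b′ ∷ bs) (descents (h′ ∷ hs))) x y s
  with ∈-from1⁻ m x∈ | ∈-from1⁻ m y∈
... | i , _ , refl | j , _ , refl =
  trans (cong₂ _∧_ (stripCompat-code i j b b′ h h′ r)
                   (stripsCompat-code m (h′ ∷ hs) (suc j ∷ s) (b′ ∷ bs) rs (suc-injective ls) (suc-injective lb) (y∈ ∷ s∈)))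
        (∧-interchange (suc i ≤ᵇ suc j) _ (weaklyIncreasing (suc j ∷ s)) _)

-- Fibres over the chains of shapes

isStdTableau⁻ : ∀ k la p ps → T (isStdTableau k la (p ∷ ps)) →
  T (isCore k p) × T (validSteps k p ps) × T (subsetC (cells (lastPart p ps)) (cells la)) × T (subsetC (cells la) (cells (lastPart p ps)))
isStdTableau⁻ k la p ps t with T-∧⁻ {isStrictPartition la} t
... | _ , t with T-∧⁻ {isCore k p} t
... | core , t with T-∧⁻ {validSteps k p ps} t
... | valid , t with T-∧⁻ {isStrictPartition (lastPart p ps)} t
... | _ , t with T-∧⁻ {subsetC (cells (lastPart p ps)) (cells la)} t
... | sub , sup = core , valid , sub , sup

∑Fcoef : ℕ → List ℕ → Chain → ℕ
∑Fcoef k α ch = ∑ (sublists (from1 (size ch))) (λ M → Fcoef (size ch) (DesMarked k (ch , M)) α)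

∑Fcoef≡∑bools : ∀ k α p ps → Linked Consecutive (headsFrom k p ps) →
  ∑Fcoef k α (p ∷ ps) ≡
  ∑ (listsOfLength (length ps) bools) (λ b → Fcoef (length ps) (indices 1 (markedDescents b (descents (headsFrom k p ps)))) α)
∑Fcoef≡∑bools k α p ps linked = trans (∑-sublists-from1 n)
  (∑-cong (listsOfLength n bools) (λ {b} b∈ → cong (λ D → Fcoef n D α)
    (ValidChain.DesMarked≡ k p ps linked b (proj₁ (∈-listsOfLength⁻ n bools b∈)))))
  where
  n : ℕ
  n = length ps

-- After the sums are exchanged, the marks b are fixed first, and the admissible value sequences s
-- are those counted by F at the marked descent set of b. Over a chain that is no tableau both sides
-- vanish.
∑semistandard : ∀ k la α p ps → Strict p → All Strict ps →
  ∑ (listsOfLength (length ps) (from1 (length α))) (λ s →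
    ∑ (listsOfLength (length ps) bools) (λ b → ⟦ isSSTableau k la α (p , zipWith _,_ ps (zipWith code s b)) ⟧)) ≡
  (if isStdTableau k la (p ∷ ps) then ∑Fcoef k α (p ∷ ps) else 0)
∑semistandard k la α p ps sp sps = trans
  (∑-cong ss (λ s∈ → ∑-cong bs (λ b∈ → cong ⟦_⟧ (split s∈ b∈)))) (by-std (isStdTableau k la (p ∷ ps)) refl)
  where
  n : ℕ
  n = length ps
  hs : List Cell
  hs = headsFrom k p ps
  ss : List (List ℕ)
  ss = listsOfLength n (from1 (length α))
  bs : List (List Bool)
  bs = listsOfLength n bools
  split : ∀ {s b} → s ∈ ss → b ∈ bs → isSSTableau k la α (p , zipWith _,_ ps (zipWith code s b)) ≡
    isStdTableau k la (p ∷ ps) ∧ (stripsCompat nothing hs (zipWith code s b) ∧ hasContent α s)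
  split {s} {b} s∈ b∈ = isSSTableau-split k la α p ps s b (proj₁ (∈-listsOfLength⁻ n _ s∈))
    (proj₁ (∈-listsOfLength⁻ n bools b∈)) (proj₂ (∈-listsOfLength⁻ n _ s∈))
  by-std : ∀ v → isStdTableau k la (p ∷ ps) ≡ v →
    ∑ ss (λ s → ∑ bs (λ b → ⟦ v ∧ (stripsCompat nothing hs (zipWith code s b) ∧ hasContent α s) ⟧)) ≡
    (if v then ∑Fcoef k α (p ∷ ps) else 0)
  by-std false _   = trans (∑-ext ss (λ _ → ∑-0 bs)) (∑-0 ss)
  by-std true  std = begin
    ∑ ss (λ s → ∑ bs (λ b → ⟦ stripsCompat nothing hs (zipWith code s b) ∧ hasContent α s ⟧))
      ≡⟨ ∑-cong ss (λ s∈ → ∑-cong bs (λ b∈ → cong ⟦_⟧ (pointwise s∈ b∈))) ⟩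
    ∑ ss (λ s → ∑ bs (λ b → ⟦ weaklyIncreasing s ∧ increasesAt (markedDescents b (descents hs)) s ∧ hasContent α s ⟧))
      ≡⟨ ∑-swap ss bs ⟩
    ∑ bs (λ b → ∑ ss (λ s → ⟦ weaklyIncreasing s ∧ increasesAt (markedDescents b (descents hs)) s ∧ hasContent α s ⟧))
      ≡⟨ ∑-ext bs (λ b → length-filterᵇ _ ss) ⟨
    ∑ bs (λ b → Fcoef n (indices 1 (markedDescents b (descents hs))) α)
      ≡⟨ ∑Fcoef≡∑bools k α p ps linked ⟨
    ∑Fcoef k α (p ∷ ps) ∎
    where
    open ≡-Reasoning
    linked : Linked Consecutive hs
    linked = validSteps⇒Linked k p ps sp sps (proj₁ (proj₂ (isStdTableau⁻ k la p ps (subst T (sym std) tt))))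
    pointwise : ∀ {s b} → s ∈ ss → b ∈ bs → stripsCompat nothing hs (zipWith code s b) ∧ hasContent α s ≡
      weaklyIncreasing s ∧ increasesAt (markedDescents b (descents hs)) s ∧ hasContent α s
    pointwise {s} {b} s∈ b∈ = trans
      (cong (_∧ hasContent α s) (stripsCompat-code (length α) hs s b linked
        (trans (proj₁ (∈-listsOfLength⁻ n _ s∈)) (sym (length-headsFrom k p ps)))
        (trans (proj₁ (∈-listsOfLength⁻ n bools b∈)) (sym (length-headsFrom k p ps)))
        (proj₂ (∈-listsOfLength⁻ n _ s∈))))
      (∧-assoc (weaklyIncreasing s) _ _)

lengths : Part → List ℕ
lengths la = applyUpTo (λ i → i) (suc (sum la))

-- Splits off the initial shape, to match the nesting of the enumeration in `RQcoef`.
∑-stdTableaux : ∀ k la (f : Chain → ℕ) → ∑ (stdTableaux k la) f ≡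
  ∑ (subparts la) (λ p → ∑ (lengths la) (λ t → ∑ (listsOfLength t (subparts la)) (λ ps →
    if isStdTableau k la (p ∷ ps) then f (p ∷ ps) else 0)))
∑-stdTableaux k la f = begin
  ∑ (stdTableaux k la) f
    ≡⟨ ∑-filterᵇ (isStdTableau k la) (concatMap chains (lengths la)) ⟩
  ∑ (concatMap chains (lengths la)) (λ ch → if isStdTableau k la ch then f ch else 0)
    ≡⟨ ∑-concatMap chains (lengths la) ⟩
  ∑ (lengths la) (λ t → ∑ (chains t) (λ ch → if isStdTableau k la ch then f ch else 0))
    ≡⟨ ∑-ext (lengths la) (λ t → ∑-listsOfLength-suc t (subparts la)) ⟩
  ∑ (lengths la) (λ t → ∑ (subparts la) (λ p → ∑ (listsOfLength t (subparts la)) (λ ps →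
    if isStdTableau k la (p ∷ ps) then f (p ∷ ps) else 0)))
    ≡⟨ ∑-swap (lengths la) (subparts la) ⟩
  ∑ (subparts la) (λ p → ∑ (lengths la) (λ t → ∑ (listsOfLength t (subparts la)) (λ ps →
    if isStdTableau k la (p ∷ ps) then f (p ∷ ps) else 0))) ∎
  where
  open ≡-Reasoning
  chains : ℕ → List Chain
  chains t = listsOfLength (suc t) (subparts la)

RQcoef≡∑Fcoef : ∀ k la α → RQcoef k la α ≡ ∑ (stdTableaux k la) (∑Fcoef k α)
RQcoef≡∑Fcoef k la α = begin
  RQcoef k la α
    ≡⟨ length-filterᵇ (isSSTableau k la α) (concatMap tableaux S) ⟩
  ∑ (concatMap tableaux S) (λ X → ⟦ isSSTableau k la α X ⟧)
    ≡⟨ ∑-concatMap tableaux S ⟩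
  ∑ S (λ p → ∑ (tableaux p) (λ X → ⟦ isSSTableau k la α X ⟧))
    ≡⟨ ∑-ext S (λ p → trans (∑-concatMap (λ t → map (p ,_) (sts t)) (lengths la)) (∑-ext (lengths la) (λ t → ∑-map (sts t)))) ⟩
  ∑ S (λ p → ∑ (lengths la) (λ t → ∑ (sts t) (λ st → ⟦ isSSTableau k la α (p , st) ⟧)))
    ≡⟨ ∑-cong S (λ p∈ → ∑-ext (lengths la) (λ t → fibre t p∈)) ⟩
  ∑ S (λ p → ∑ (lengths la) (λ t → ∑ (listsOfLength t S) (λ ps →
    if isStdTableau k la (p ∷ ps) then ∑Fcoef k α (p ∷ ps) else 0)))
    ≡⟨ ∑-stdTableaux k la (∑Fcoef k α) ⟨
  ∑ (stdTableaux k la) (∑Fcoef k α) ∎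
  where
  open ≡-Reasoning
  S : List Part
  S = subparts la
  C : List ℕ
  C = from1 (2 * length α)
  sts : ℕ → List (List (Part × ℕ))
  sts t = listsOfLength t (cartesianProduct S C)
  tableaux : Part → List (Part × List (Part × ℕ))
  tableaux p = concatMap (λ t → map (p ,_) (sts t)) (lengths la)
  fibre : ∀ t {p} → p ∈ S → ∑ (sts t) (λ st → ⟦ isSSTableau k la α (p , st) ⟧) ≡
    ∑ (listsOfLength t S) (λ ps → if isStdTableau k la (p ∷ ps) then ∑Fcoef k α (p ∷ ps) else 0)
  fibre t {p} p∈ = begin
    ∑ (sts t) (λ st → ⟦ isSSTableau k la α (p , st) ⟧)
      -- First the shapes are separated from the codes, then each code is split into a value and a
      -- mark.
      ≡⟨ ∑-listsOfLength-zipWith _,_ (cartesianProduct S C) S C (λ F → ∑-cartesianProduct S C) t _ ⟩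
    ∑ (listsOfLength t S) (λ ps → ∑ (listsOfLength t C) (λ cs → ⟦ isSSTableau k la α (p , zipWith _,_ ps cs) ⟧))
      ≡⟨ ∑-ext (listsOfLength t S) (λ ps →
           ∑-listsOfLength-zipWith code C (from1 (length α)) bools (∑-from1-code (length α)) t _) ⟩
    ∑ (listsOfLength t S) (λ ps → ∑ (listsOfLength t (from1 (length α))) (λ s → ∑ (listsOfLength t bools) (λ b →
      ⟦ isSSTableau k la α (p , zipWith _,_ ps (zipWith code s b)) ⟧)))
      ≡⟨ ∑-cong (listsOfLength t S) at-chain ⟩
    ∑ (listsOfLength t S) (λ ps → if isStdTableau k la (p ∷ ps) then ∑Fcoef k α (p ∷ ps) else 0) ∎
    where
    at-chain : ∀ {ps} → ps ∈ listsOfLength t S →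
      ∑ (listsOfLength t (from1 (length α))) (λ s → ∑ (listsOfLength t bools) (λ b →
        ⟦ isSSTableau k la α (p , zipWith _,_ ps (zipWith code s b)) ⟧)) ≡
      (if isStdTableau k la (p ∷ ps) then ∑Fcoef k α (p ∷ ps) else 0)
    at-chain {ps} ps∈ with ∈-listsOfLength⁻ t S ps∈
    ... | refl , ps⊆S = ∑semistandard k la α p ps (∈-subparts⇒strict la p∈) (All.map (∈-subparts⇒strict la) ps⊆S)

-- At least one ribbon is required: the count of markings uses one mark more than there are letters,
-- which fails for n = 0, where n ∸ 1 is also 0.
∑Fcoef≡Gcoef : ∀ k α p q ps → Linked Consecutive (headsFrom k p (q ∷ ps)) →
  ∑Fcoef k α (p ∷ q ∷ ps) ≡
  2 ^ (length (Peak (Des k (p ∷ q ∷ ps))) + 1) * Gcoef (size (p ∷ q ∷ ps)) (Peak (Des k (p ∷ q ∷ ps))) α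
∑Fcoef≡Gcoef k α p q ps linked = trans (∑Fcoef≡∑bools k α p (q ∷ ps) linked)
  (subst (λ D → ∑ (listsOfLength (suc (length ps)) bools) (λ b → Fcoef (suc (length ps)) (indices 1 (markedDescents b ds)) α) ≡
                2 ^ (length (Peak D) + 1) * Gcoef (suc (length ps)) (Peak D) α) (sym (ValidChain.Des≡ k p (q ∷ ps) linked))
    (subst (λ n → ∑ (listsOfLength (suc n) bools) (λ b → Fcoef (suc n) (indices 1 (markedDescents b ds)) α) ≡
                  2 ^ (length (Peak (indices 1 ds)) + 1) * Gcoef (suc n) (Peak (indices 1 ds)) α)
           (ValidChain.length-ds k p (q ∷ ps) linked)
           (∑marks-indices (λ D → Fcoef (suc (length ds)) D α) ds)))
  where
  ds : List Bool
  ds = descents (headsFrom k p (q ∷ ps))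

∑-cong-if : {A : Set} {f g : A → ℕ} (c : A → Bool) (xs : List A) →
  (∀ {x} → x ∈ xs → T (c x) → f x ≡ g x) → ∑ xs (λ x → if c x then f x else 0) ≡ ∑ xs (λ x → if c x then g x else 0)
∑-cong-if {f = f} {g} c xs eq = ∑-cong xs (λ x∈ → go _ (eq x∈))
  where
  go : ∀ x → (T (c x) → f x ≡ g x) → (if c x then f x else 0) ≡ (if c x then g x else 0)
  go x e with c x
  ... | true  = e tt
  ... | false = refl

-- A chain without ribbons begins and ends at the same shape, so λ is its initial core. This
-- excludes n = 0 from the peak formula.
trivial⇒core : ∀ k la p → T (isStrictPartition la) → Strict p → T (isStdTableau k la (p ∷ [])) → T (isCore k la)
trivial⇒core k la p sla sp std with isStdTableau⁻ k la p [] std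
... | core , _ , sub , sup = subst (T ∘ isCore k)
  (cellsFrom-injective 1 p la sp sla (subsetC⁻ (cells p) (cells la) sub) (subsetC⁻ (cells la) (cells p) sup)) core

mainTheorem5 : (k : ℕ) → 1 ≤ k → (la : Part) → T (isStrictPartition la) →
    (α : List ℕ) →
    (RQcoef k la α
    ≡ sum (map (λ Tm → Fcoef (size (proj₁ Tm)) (DesMarked k Tm) α)
    (markedTableaux k la)))
    × (¬ T (isCore k la) →
    RQcoef k la α
    ≡ sum (map (λ ch → 2 ^ (length (Peak (Des k ch)) + 1)
    * Gcoef (size ch) (Peak (Des k ch)) α)
    (stdTableaux k la)))
mainTheorem5 k _ la sla α = trans (RQcoef≡∑Fcoef k la α) (sym markedSum) , λ ¬core →
  trans (RQcoef≡∑Fcoef k la α) (trans (∑-stdTableaux k la (∑Fcoef k α)) (trans (peakSum ¬core) (sym (∑-stdTableaux k la G))))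
  where
  G : Chain → ℕ
  G ch = 2 ^ (length (Peak (Des k ch)) + 1) * Gcoef (size ch) (Peak (Des k ch)) α
  markedSum : ∑ (markedTableaux k la) (λ Tm → Fcoef (size (proj₁ Tm)) (DesMarked k Tm) α) ≡ ∑ (stdTableaux k la) (∑Fcoef k α)
  markedSum = trans (∑-concatMap (λ ch → map (ch ,_) (sublists (from1 (size ch)))) (stdTableaux k la)) (∑-ext (stdTableaux k la) (λ ch → ∑-map (sublists (from1 (size ch)))))
  fibre : ¬ T (isCore k la) → ∀ {p ps} → Strict p → All Strict ps → T (isStdTableau k la (p ∷ ps)) →
    ∑Fcoef k α (p ∷ ps) ≡ G (p ∷ ps)
  fibre ¬core {p} {[]}     sp sps std = contradiction (trivial⇒core k la p sla sp std) ¬core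
  fibre ¬core {p} {q ∷ ps} sp sps std = ∑Fcoef≡Gcoef k α p q ps
    (validSteps⇒Linked k p (q ∷ ps) sp sps (proj₁ (proj₂ (isStdTableau⁻ k la p (q ∷ ps) std))))
  peakSum : ¬ T (isCore k la) →
    ∑ (subparts la) (λ p → ∑ (lengths la) (λ t → ∑ (listsOfLength t (subparts la)) (λ ps →
      if isStdTableau k la (p ∷ ps) then ∑Fcoef k α (p ∷ ps) else 0))) ≡
    ∑ (subparts la) (λ p → ∑ (lengths la) (λ t → ∑ (listsOfLength t (subparts la)) (λ ps →
      if isStdTableau k la (p ∷ ps) then G (p ∷ ps) else 0)))
  peakSum ¬core = ∑-cong (subparts la) (λ {p} p∈ → ∑-ext (lengths la) (λ t →
    ∑-cong-if {f = λ ps → ∑Fcoef k α (p ∷ ps)} {g = λ ps → G (p ∷ ps)} (λ ps → isStdTableau k la (p ∷ ps)) (listsOfLength t (subparts la)) (λ ps∈ std → fibre ¬core (∈-subparts⇒strict la p∈) (All.map (∈-subparts⇒strict la) (proj₂ (∈-listsOfLength⁻ t (subparts la) ps∈))) std)))
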